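{- Let $C$ be a DeMorgan circuit on $n$ inputs with size $s < 3(n-1)$ that claims to compute $\mathrm{XOR}_n$. Then, given $C$, one can construct an input $x \in \{0,1\}^n$ such that $C(x) \neq \mathrm{XOR}_n(x)$ in polynomial time with respect to $n$.
   Context: A DeMorgan circuit on $n$ inputs is a single-output Boolean circuit (directed acyclic graph of gates) over the basis consisting of binary $\land$, binary $\lor$, unary $\neg$ and the constants $0,1$, with input variables $x_1,\dots,x_n$. The size of a circuit is its number of binary gates ($\land$ and $\lor$ gates); $\neg$ gates are free, i.e. not counted. $C(x)$ denotes the value of the output gate of $C$ on input $x$. For $x=(x_1,\dots,x_n)\in\{0,1\}^n$, $\mathrm{XOR}_n(x)=\left(\sum_{i=1}^n x_i\right)\bmod 2$. The phrase "claims to compute $\mathrm{XOR}_n$" only says that $C$ is put forward as a circuit for $\mathrm{XOR}_n$; it imposes no further condition on $C$.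
   Formalization: The running time is polynomial in n plus the number of ¬ and constant gates of C, not in n alone: these gates are not counted in the size, and with unboundedly long chains of ¬ gates a bound in n alone is false. -}

module Defs where

open import Data.Bool.Base using (Bool; true; false; _∧_; _∨_; not)
open import Data.Fin.Base using (Fin; zero; suc; toℕ)
open import Data.List.Base using (List; foldr)
open import Data.Nat.Base using (ℕ; zero; suc; _+_; _*_; _%_)
open import Data.Product.Base using (∃; _×_)
open import Data.Vec.Base as Vec using (Vec; []; _∷_; lookup; replicate; _[_]≔_)
open import Relation.Binary.PropositionalEquality.Core using (_≡_)

data Gate (w : ℕ) : Set where
  const   : Bool → Gate w
  neg     : Fin w → Gate w
  and or  : Fin w → Fin w → Gate w

-- A circuit DAG is given by its gates in topological order.  The index is the
-- number of wires available so far: initially the n inputs, where Fin index i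
-- is the i-th input.  Each gate adds its own wire as index zero and shifts the
-- others up by one.  Wires may be reused (arbitrary fan-out) or left unused.
infixr 5 _▷_
data Circuit (w : ℕ) : Set where
  output : Fin w → Circuit w
  _▷_    : Gate w → Circuit (suc w) → Circuit w

evalGate : ∀ {w} → Gate w → Vec Bool w → Bool
evalGate (const b) v = b
evalGate (neg i)   v = not (lookup v i)
evalGate (and i j) v = lookup v i ∧ lookup v j
evalGate (or i j)  v = lookup v i ∨ lookup v j

eval : ∀ {w} → Circuit w → Vec Bool w → Bool
eval (output i) v = lookup v i
eval (g ▷ C)    v = eval C (evalGate g v ∷ v)

size : ∀ {w} → Circuit w → ℕ
size (output _)      = 0
size (const _ ▷ C)   = size C
size (neg _ ▷ C)     = size C
size (and _ _ ▷ C)   = suc (size C)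
size (or _ _ ▷ C)    = suc (size C)

-- The number of gates that size does not count.  No function of n and size
-- bounds it (¬ gates may be chained arbitrarily), yet they are part of the
-- description of the circuit that an algorithm has to read.
freeGates : ∀ {w} → Circuit w → ℕ
freeGates (output _)      = 0
freeGates (const _ ▷ C)   = suc (freeGates C)
freeGates (neg _ ▷ C)     = suc (freeGates C)
freeGates (and _ _ ▷ C)   = freeGates C
freeGates (or _ _ ▷ C)    = freeGates C

bit : Bool → ℕ
bit false = 0
bit true  = 1

XOR : ∀ {n} → Vec Bool n → ℕ
XOR x = Vec.sum (Vec.map bit x) % 2

-- Polynomial time refers to the WHILE language over binary trees of N. D. Jones,
-- "Computability and Complexity from a Programming Perspective", with if as an
-- additional primitive.  Every tree operation, assignment and test takes unit
-- time; this model is polynomial-time equivalent to Turing machines.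

data Tree : Set where
  nil  : Tree
  cons : Tree → Tree → Tree

head tail : Tree → Tree
head nil        = nil
head (cons a _) = a
tail nil        = nil
tail (cons _ b) = b

data Expr (k : ℕ) : Set where
  var   : Fin k → Expr k
  nil   : Expr k
  cons  : Expr k → Expr k → Expr k
  hd tl : Expr k → Expr k

data Cmd (k : ℕ) : Set where
  _≔_           : Fin k → Expr k → Cmd k
  _⨾_           : Cmd k → Cmd k → Cmd k
  if_then_else_ : Expr k → Cmd k → Cmd k → Cmd k
  while_loop_     : Expr k → Cmd k → Cmd k

Store : ℕ → Set
Store k = Vec Tree k

⟦_⟧ : ∀ {k} → Expr k → Store k → Tree
⟦ var x ⟧    σ = lookup σ x
⟦ nil ⟧      σ = nil
⟦ cons e f ⟧ σ = cons (⟦ e ⟧ σ) (⟦ f ⟧ σ)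
⟦ hd e ⟧     σ = head (⟦ e ⟧ σ)
⟦ tl e ⟧     σ = tail (⟦ e ⟧ σ)

cost : ∀ {k} → Expr k → ℕ
cost (var x)    = 1
cost nil        = 1
cost (cons e f) = suc (cost e + cost f)
cost (hd e)     = suc (cost e)
cost (tl e)     = suc (cost e)

-- c ∶ σ ⇓ τ [ t ]: started in store σ, the command c halts in store τ after
-- time t.  A test is false exactly when its value is nil.
data _∶_⇓_[_] {k : ℕ} : Cmd k → Store k → Store k → ℕ → Set where
  assign : ∀ {x e σ} →
    (x ≔ e) ∶ σ ⇓ (σ [ x ]≔ ⟦ e ⟧ σ) [ suc (cost e) ]
  seq : ∀ {c d ρ σ τ s t} →
    c ∶ ρ ⇓ σ [ s ] → d ∶ σ ⇓ τ [ t ] →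
    (c ⨾ d) ∶ ρ ⇓ τ [ suc (s + t) ]
  if-true : ∀ {e c d σ τ a b t} →
    ⟦ e ⟧ σ ≡ cons a b → c ∶ σ ⇓ τ [ t ] →
    (if e then c else d) ∶ σ ⇓ τ [ suc (cost e + t) ]
  if-false : ∀ {e c d σ τ t} →
    ⟦ e ⟧ σ ≡ nil → d ∶ σ ⇓ τ [ t ] →
    (if e then c else d) ∶ σ ⇓ τ [ suc (cost e + t) ]
  while-true : ∀ {e c ρ σ τ a b s t} →
    ⟦ e ⟧ ρ ≡ cons a b → c ∶ ρ ⇓ σ [ s ] → (while e loop c) ∶ σ ⇓ τ [ t ] →
    (while e loop c) ∶ ρ ⇓ τ [ suc (cost e + s + t) ]
  while-false : ∀ {e c σ} →
    ⟦ e ⟧ σ ≡ nil →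
    (while e loop c) ∶ σ ⇓ σ [ suc (cost e) ]

-- Variable zero holds the input at the start and the output at the end; the
-- other variables start as nil.
record Program : Set where
  constructor program
  field
    extraVars : ℕ
    body      : Cmd (suc extraVars)

_on_outputs_inTime_ : Program → Tree → Tree → ℕ → Set
program k c on a outputs b inTime t =
  ∃ λ τ → (c ∶ (a ∷ replicate k nil) ⇓ τ [ t ]) × lookup τ zero ≡ b

encodeℕ : ℕ → Tree
encodeℕ zero    = nil
encodeℕ (suc n) = cons nil (encodeℕ n)

encodeBool : Bool → Tree
encodeBool false = nil
encodeBool true  = cons nil nil

encodeBits : ∀ {n} → Vec Bool n → Tree
encodeBits []      = nil
encodeBits (b ∷ x) = cons (encodeBool b) (encodeBits x)

encodeFin : ∀ {w} → Fin w → Tree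
encodeFin i = encodeℕ (toℕ i)

encodeGate : ∀ {w} → Gate w → Tree
encodeGate (const b) = cons (encodeℕ 0) (encodeBool b)
encodeGate (neg i)   = cons (encodeℕ 1) (encodeFin i)
encodeGate (and i j) = cons (encodeℕ 2) (cons (encodeFin i) (encodeFin j))
encodeGate (or i j)  = cons (encodeℕ 3) (cons (encodeFin i) (encodeFin j))

-- The code of a gate is never nil, so the first component tells the two
-- cases apart.
encodeCircuit : ∀ {w} → Circuit w → Tree
encodeCircuit (output i) = cons nil (encodeFin i)
encodeCircuit (g ▷ C)    = cons (encodeGate g) (encodeCircuit C)

encodeInput : ∀ n → Circuit n → Tree
encodeInput n C = cons (encodeℕ n) (encodeCircuit C)

-- Polynomials with natural coefficients, constant term first.
Polynomial : Set
Polynomial = List ℕ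

evalPoly : Polynomial → ℕ → ℕ
evalPoly p m = foldr (λ a r → a + m * r) 0 p

{-# OPTIONS --safe #-}

-- Gate elimination (Schnorr).  Simplify the circuit under a partial assignment,
-- writing it with ∧-gates between possibly negated wires.  If a circuit with at
-- least two free inputs computes parity, some gate γ that reaches the output
-- reads two inputs xᵢ and xⱼ.  Then xᵢ feeds a second gate η, for otherwise xⱼ
-- could hide xᵢ by falsifying γ; and assigning to xᵢ the value that falsifies γ
-- removes γ, η and a gate fed by γ, or, if that gate is η, a gate fed by η,
-- which has become constant.  Hence fewer than 3(n − 1) gates cannot suffice.
--
-- Every use of the assumption that parity is computed compares two inputs in
-- which at most two free variables are set and the others are 0.  So there is
-- no need to find γ: greedily assign an input as long as this removes three
-- gates; when stuck, one of those quadratically many inputs is a counterexample.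

module Submission where

open import Defs
open import Data.Bool.Base using (Bool; true; false; not; _xor_)
open import Data.Bool.Properties
  using (not-injective; xor-identityʳ; not-distribˡ-xor; not-distribʳ-xor)
open import Data.Empty using (⊥; ⊥-elim)
open import Data.Fin.Base using (Fin; zero; suc; toℕ)
import Data.Fin.Properties as Fin
open import Data.Fin.Properties using (toℕ<n)
open import Data.List.Base as List
  using (List; []; _∷_; _++_; foldl; foldr; length; replicate; take)
open import Data.List.Membership.Propositional using (_∈_)
open import Data.List.Membership.Propositional.Properties
  using (∈-∃++; ∈-++⁺ˡ; ∈-++⁺ʳ; ∈-++⁻; ∈-map⁺; ∈-map⁻)
open import Data.List.Properties
  using (foldl-cong; length-++; length-map; length-reverse; reverse-foldl; take-[]; take-all)
open import Data.List.Relation.Unary.All as All using (All; []; _∷_)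
open import Data.List.Relation.Unary.AllPairs using ([]; _∷_)
open import Data.List.Relation.Unary.Any using (here; there)
open import Data.List.Relation.Unary.Any.Properties using (reverse⁺; reverse⁻)
open import Data.List.Relation.Unary.Unique.Propositional using (Unique)
open import Data.Nat.Base
  using (ℕ; zero; suc; _+_; _*_; _∸_; _%_; _≤_; _<_; z≤n; s≤s; s≤s⁻¹)
open import Data.Nat.DivMod using (%-distribˡ-+)
open import Data.Nat.Induction using (<-wellFounded)
open import Data.Nat.Properties
open import Data.Nat.Tactic.RingSolver using (solve-∀)
open import Data.Product.Base using (∃; ∃₂; _×_; _,_; proj₁; proj₂)
open import Data.Sum.Base using (_⊎_; inj₁; inj₂; [_,_]′)
open import Data.Unit.Base using (⊤; tt)
open import Data.Vec.Base as Vec using (Vec; []; _∷_; lookup; _[_]≔_)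
open import Data.Vec.Properties
  using (lookup-map; lookup∘update; lookup∘update′; tabulate-cong; tabulate∘lookup)
open import Function.Base using (_∘_)
import Induction.WellFounded as WF
open import Relation.Binary.PropositionalEquality
open import Relation.Nullary using (¬_; yes; no; contradiction)

-- `refuted` is a pure contradiction: not all candidates can be correct, but none is named. An
-- actual input comes from running over the finitely many candidates, as correctness of each one is
-- decidable. The invariant `Cheap` drives the greedy phase: a step removes at least three gates and
-- at most one free input, so that two free inputs are still there when no step is left. Time is
-- kept apart from the algorithm. Terms iterate only by folds over at most `K` elements, so the
-- running time of compiled code is bounded by its shape, whatever it computes; what remains is to
-- choose `K` so large that no fold of the refuter is cut short. Such a `K` cannot depend on `n`
-- alone: free gates have to be read as well, hence the measure `n + freeGates C`.

-- Static time bounds for WHILE programs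

-- Every while loop is charged for N iterations.
bound : ∀ {k} → Cmd k → ℕ → ℕ
bound (x ≔ e)                N = suc (cost e)
bound (c ⨾ d)                N = suc (bound c N + bound d N)
bound (if e then c else d)   N = suc (cost e + (bound c N + bound d N))
bound (while e loop c)       N = suc (cost e) + N * suc (cost e + bound c N)

record Runs {k} (N : ℕ) (c : Cmd k) (σ τ : Store k) : Set where
  constructor within
  field
    {steps} : ℕ
    run     : c ∶ σ ⇓ τ [ steps ]
    steps≤  : steps ≤ bound c N

-- The iterations left, `j`, are kept apart from the allowance `N`: induction over a loop counts `j`
-- down, while the body is charged with the same `N` throughout.
record RunsLoop {k} (N j : ℕ) (e : Expr k) (c : Cmd k) (σ τ : Store k) : Set where
  constructor within
  field
    {steps} : ℕ
    run     : (while e loop c) ∶ σ ⇓ τ [ steps ]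
    steps≤  : steps ≤ suc (cost e) + j * suc (cost e + bound c N)

module _ {k N : ℕ} where

  assignᵣ : ∀ {x : Fin k} {e σ} → Runs N (x ≔ e) σ (σ Vec.[ x ]≔ ⟦ e ⟧ σ)
  assignᵣ = within assign ≤-refl

  infixr 4 _⨾ᵣ_
  _⨾ᵣ_ : ∀ {c d : Cmd k} {ρ σ τ} → Runs N c ρ σ → Runs N d σ τ → Runs N (c ⨾ d) ρ τ
  within r p ⨾ᵣ within s q = within (seq r s) (s≤s (+-mono-≤ p q))

  thenᵣ : ∀ {e : Expr k} {c d σ τ a b} → ⟦ e ⟧ σ ≡ cons a b → Runs N c σ τ →
    Runs N (if e then c else d) σ τ
  thenᵣ {e} eq (within r p) =
    within (if-true eq r) (s≤s (+-monoʳ-≤ (cost e) (≤-trans p (m≤m+n _ _))))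

  elseᵣ : ∀ {e : Expr k} {c d σ τ} → ⟦ e ⟧ σ ≡ nil → Runs N d σ τ →
    Runs N (if e then c else d) σ τ
  elseᵣ {e} eq (within r p) =
    within (if-false eq r) (s≤s (+-monoʳ-≤ (cost e) (≤-trans p (m≤n+m _ _))))

  stopᵣ : ∀ {e : Expr k} {c σ j} → ⟦ e ⟧ σ ≡ nil → RunsLoop N j e c σ σ
  stopᵣ eq = within (while-false eq) (m≤m+n _ _)

  stepᵣ : ∀ {e : Expr k} {c ρ σ τ a b j} → ⟦ e ⟧ ρ ≡ cons a b →
    Runs N c ρ σ → RunsLoop N j e c σ τ → RunsLoop N (suc j) e c ρ τ
  stepᵣ {e} {c} {j = j} eq (within {s} r p) (within {t} r′ q) = within (while-true eq r r′) (begin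
    suc (cost e + s + t)
      ≤⟨ s≤s (+-mono-≤ (+-monoʳ-≤ (cost e) p) q) ⟩
    suc (cost e + B + (suc (cost e) + j * suc (cost e + B)))
      ≡⟨ arith (cost e) B (j * suc (cost e + B)) ⟩
    suc (cost e) + suc j * suc (cost e + B) ∎)
    where
    open ≤-Reasoning
    B = bound c N
    arith : ∀ x y z → suc (x + y + (suc x + z)) ≡ suc x + (suc (x + y) + z)
    arith = solve-∀

  loopᵣ : ∀ {e : Expr k} {c σ τ j} → j ≤ N → RunsLoop N j e c σ τ → Runs N (while e loop c) σ τ
  loopᵣ {e} {c} j≤N (within r p) =
    within r (≤-trans p (+-monoʳ-≤ (suc (cost e)) (*-monoˡ-≤ (suc (cost e + bound c N)) j≤N)))

-- A functional language and its compiler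

spine : Tree → List Tree
spine nil        = []
spine (cons a b) = a ∷ spine b

∣_∣ : Tree → ℕ
∣ nil ∣      = 0
∣ cons _ b ∣ = suc ∣ b ∣

data Term (Γ : ℕ) : Set where
  var           : Fin Γ → Term Γ
  nil           : Term Γ
  cons          : Term Γ → Term Γ → Term Γ
  hd tl         : Term Γ → Term Γ
  if_then_else_ : Term Γ → Term Γ → Term Γ → Term Γ
  fold          : Term Γ → Term Γ → Term (suc (suc Γ)) → Term Γ
  call          : ∀ {Δ} → Term Δ → Vec (Term Γ) Δ → Term Γ

ifT : Tree → Tree → Tree → Tree
ifT nil        s t = t
ifT (cons _ _) s t = s

-- The value of a term.  A fold is a left fold along the right spine of a tree;
-- it is cut off after K elements, which makes the running time polynomial in K
-- whatever the term is.
module _ (K : ℕ) where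
  mutual
    value : ∀ {Γ} → Term Γ → Vec Tree Γ → Tree
    value (var i)              ρ = lookup ρ i
    value nil                  ρ = nil
    value (cons t u)           ρ = cons (value t ρ) (value u ρ)
    value (hd t)               ρ = head (value t ρ)
    value (tl t)               ρ = tail (value t ρ)
    value (if t then u else v) ρ = ifT (value t ρ) (value u ρ) (value v ρ)
    value (fold l z b)         ρ =
      foldl (λ acc e → value b (acc ∷ e ∷ ρ)) (value z ρ) (take K (spine (value l ρ)))
    value (call f ts)          ρ = value f (values ts ρ)

    values : ∀ {Γ Δ} → Vec (Term Γ) Δ → Vec Tree Γ → Vec Tree Δ
    values []       ρ = []
    values (t ∷ ts) ρ = value t ρ ∷ values ts ρ

-- The store holds the value just computed, the environment (a list), a stack
-- and a list of length K that counts the iterations of folds.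
pattern acc# = zero
pattern env# = suc zero
pattern stk# = suc (suc zero)
pattern ful# = suc (suc (suc zero))

acc env stk ful : Expr 4
acc = var acc#
env = var env#
stk = var stk#
ful = var ful#

drop : ∀ {Γ} → Fin Γ → Expr 4 → Expr 4
drop zero    e = e
drop (suc i) e = drop i (tl e)

infix  5 _:=_
infixr 4 _⟫_

_:=_ : Fin 4 → Expr 4 → Cmd 4
_:=_ = _≔_

_⟫_ : Cmd 4 → Cmd 4 → Cmd 4
_⟫_ = _⨾_

mutual
  compile : ∀ {Γ} → Term Γ → Cmd 4
  compile (var i)              = acc# := hd (drop i env)
  compile nil                  = acc# := nil
  compile (cons t u)           =
    compile t ⟫ stk# := cons acc stk ⟫ compile u ⟫
    acc# := cons (hd stk) acc ⟫ stk# := tl stk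
  compile (hd t)               = compile t ⟫ acc# := hd acc
  compile (tl t)               = compile t ⟫ acc# := tl acc
  compile (if t then u else v) = compile t ⟫ if acc then compile u else compile v
  compile (fold l z b)         =
    compile l ⟫ stk# := cons acc stk ⟫ compile z ⟫
    stk# := cons ful stk ⟫
    while hd stk loop iteration b ⟫
    stk# := tl (tl stk)
  compile (call f ts)          =
    stk# := cons nil stk ⟫ compiles ts ⟫
    stk# := cons env stk ⟫ env# := hd (tl stk) ⟫ compile f ⟫
    env# := hd stk ⟫ stk# := tl (tl stk)

  -- The top of the stack is the loop counter, followed by the rest of the list.
  iteration : ∀ {Γ} → Term (suc (suc Γ)) → Cmd 4
  iteration b =
    if hd (tl stk)
    then (env# := cons acc (cons (hd (hd (tl stk))) env) ⟫
          stk# := cons (tl (hd stk)) (cons (tl (hd (tl stk))) (tl (tl stk))) ⟫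
          compile b ⟫
          env# := tl (tl env))
    -- The list has run out before the counter. Only the counter goes down, so that the loop always
    -- makes as many iterations as the fuel is long.
    else (stk# := cons (tl (hd stk)) (tl stk))

  compiles : ∀ {Γ Δ} → Vec (Term Γ) Δ → Cmd 4
  compiles []       = acc# := nil
  compiles (t ∷ ts) =
    -- The last argument is evaluated first, because each value is consed in front of those already
    -- collected.
    compiles ts ⟫ compile t ⟫ stk# := cons (cons acc (hd stk)) (tl stk)

tree : ∀ {n} → Vec Tree n → Tree
tree []      = nil
tree (a ∷ ρ) = cons a (tree ρ)

drop-correct : ∀ {Γ} (i : Fin Γ) (ρ : Vec Tree Γ) (e : Expr 4) σ →
  ⟦ e ⟧ σ ≡ tree ρ → head (⟦ drop i e ⟧ σ) ≡ lookup ρ i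
drop-correct zero    (a ∷ ρ) e σ eq = cong head eq
drop-correct (suc i) (a ∷ ρ) e σ eq = drop-correct i ρ (tl e) σ (cong tail eq)

module _ {N : ℕ} (f : Tree) (K≤N : ∣ f ∣ ≤ N) where

  private K = ∣ f ∣

  mutual
    -- Stack, environment and fuel come back unchanged and the old content of `acc` is arbitrary;
    -- this is what lets compiled subterms be run one after the other.
    compile-correct : ∀ {Γ} (t : Term Γ) ρ a s →
      Runs N (compile t) (a ∷ tree ρ ∷ s ∷ f ∷ []) (value K t ρ ∷ tree ρ ∷ s ∷ f ∷ [])
    compile-correct (var i) ρ a s =
      subst (λ b → Runs N (compile (var i)) _ (b ∷ _)) (drop-correct i ρ env _ refl) assignᵣ
    compile-correct nil ρ a s = assignᵣ
    compile-correct (cons t u) ρ a s =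
      compile-correct t ρ a s ⨾ᵣ assignᵣ ⨾ᵣ compile-correct u ρ _ _ ⨾ᵣ assignᵣ ⨾ᵣ assignᵣ
    compile-correct (hd t) ρ a s = compile-correct t ρ a s ⨾ᵣ assignᵣ
    compile-correct (tl t) ρ a s = compile-correct t ρ a s ⨾ᵣ assignᵣ
    compile-correct (if t then u else v) ρ a s
      with value K t ρ | compile-correct t ρ a s
    ... | nil      | r = r ⨾ᵣ elseᵣ refl (compile-correct v ρ _ s)
    ... | cons _ _ | r = r ⨾ᵣ thenᵣ refl (compile-correct u ρ _ s)
    compile-correct (fold l z b) ρ a s =
      compile-correct l ρ a s ⨾ᵣ assignᵣ ⨾ᵣ compile-correct z ρ _ _ ⨾ᵣ assignᵣ ⨾ᵣ
      loopᵣ K≤N (iteration-correct b ρ f (value K l ρ) (value K z ρ) s .proj₂) ⨾ᵣ assignᵣ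
    compile-correct (call g ts) ρ a s =
      assignᵣ ⨾ᵣ compiles-correct ts ρ a s .proj₂ ⨾ᵣ assignᵣ ⨾ᵣ assignᵣ ⨾ᵣ
      compile-correct g (values K ts ρ) _ _ ⨾ᵣ assignᵣ ⨾ᵣ assignᵣ

    -- `l′` is what is left of the list if the counter runs out first, which is the cut-off in
    -- `value`; it is discarded after the loop.
    iteration-correct : ∀ {Γ} (b : Term (suc (suc Γ))) ρ k l a s → ∃ λ l′ →
      RunsLoop N ∣ k ∣ (hd stk) (iteration b)
        (a ∷ tree ρ ∷ cons k (cons l s) ∷ f ∷ [])
        (foldl (λ acc e → value K b (acc ∷ e ∷ ρ)) a (take ∣ k ∣ (spine l))
          ∷ tree ρ ∷ cons nil (cons l′ s) ∷ f ∷ [])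
    iteration-correct b ρ nil        l   a s = l , stopᵣ refl
    iteration-correct b ρ (cons _ k) nil a s with iteration-correct b ρ k nil a s
    ... | l′ , r rewrite take-[] {A = Tree} ∣ k ∣ = l′ , stepᵣ refl (elseᵣ refl assignᵣ) r
    iteration-correct b ρ (cons _ k) (cons e l) a s
      with iteration-correct b ρ k l (value K b (a ∷ e ∷ ρ)) s
    ... | l′ , r = l′ ,
      stepᵣ refl (thenᵣ refl (assignᵣ ⨾ᵣ assignᵣ ⨾ᵣ compile-correct b (a ∷ e ∷ ρ) _ _ ⨾ᵣ assignᵣ)) r

    compiles-correct : ∀ {Γ Δ} (ts : Vec (Term Γ) Δ) ρ a s → ∃ λ a′ →
      Runs N (compiles ts) (a ∷ tree ρ ∷ cons nil s ∷ f ∷ [])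
        (a′ ∷ tree ρ ∷ cons (tree (values K ts ρ)) s ∷ f ∷ [])
    compiles-correct []       ρ a s = nil , assignᵣ
    compiles-correct (t ∷ ts) ρ a s with compiles-correct ts ρ a s
    ... | _ , r = _ , r ⨾ᵣ compile-correct t ρ _ _ ⨾ᵣ assignᵣ

-- Polynomial bounds

infixl 6 _⊕_
infixl 7 _⊗_

_⊕_ : Polynomial → Polynomial → Polynomial
[]      ⊕ q       = q
(a ∷ p) ⊕ []      = a ∷ p
(a ∷ p) ⊕ (b ∷ q) = a + b ∷ p ⊕ q

_⊗_ : Polynomial → Polynomial → Polynomial
[]      ⊗ q = []
(a ∷ p) ⊗ q = List.map (a *_) q ⊕ (0 ∷ p ⊗ q)

evalPoly-⊕ : ∀ p q m → evalPoly (p ⊕ q) m ≡ evalPoly p m + evalPoly q m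
evalPoly-⊕ []      q       m = refl
evalPoly-⊕ (a ∷ p) []      m = sym (+-identityʳ _)
evalPoly-⊕ (a ∷ p) (b ∷ q) m rewrite evalPoly-⊕ p q m = arith a b m (evalPoly p m) (evalPoly q m)
  where
  arith : ∀ a b m x y → a + b + m * (x + y) ≡ a + m * x + (b + m * y)
  arith = solve-∀

evalPoly-scale : ∀ a q m → evalPoly (List.map (a *_) q) m ≡ a * evalPoly q m
evalPoly-scale a []      m = sym (*-zeroʳ a)
evalPoly-scale a (b ∷ q) m rewrite evalPoly-scale a q m = arith a b m (evalPoly q m)
  where
  arith : ∀ a b m x → a * b + m * (a * x) ≡ a * (b + m * x)
  arith = solve-∀

evalPoly-⊗ : ∀ p q m → evalPoly (p ⊗ q) m ≡ evalPoly p m * evalPoly q m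
evalPoly-⊗ []      q m = refl
evalPoly-⊗ (a ∷ p) q m
  rewrite evalPoly-⊕ (List.map (a *_) q) (0 ∷ p ⊗ q) m
        | evalPoly-scale a q m | evalPoly-⊗ p q m = arith a m (evalPoly p m) (evalPoly q m)
  where
  arith : ∀ a m x y → a * y + m * (x * y) ≡ (a + m * x) * y
  arith = solve-∀

-- `p` stands for the allowance `N`, which is itself a polynomial in the measure of the input.
boundPoly : ∀ {k} → Cmd k → Polynomial → Polynomial
boundPoly (x ≔ e)              p = suc (cost e) ∷ []
boundPoly (c ⨾ d)              p = (1 ∷ []) ⊕ (boundPoly c p ⊕ boundPoly d p)
boundPoly (if e then c else d) p = (suc (cost e) ∷ []) ⊕ (boundPoly c p ⊕ boundPoly d p)
boundPoly (while e loop c)     p =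
  (suc (cost e) ∷ []) ⊕ p ⊗ ((suc (cost e) ∷ []) ⊕ boundPoly c p)

boundPoly-correct : ∀ {k} (c : Cmd k) p m →
  evalPoly (boundPoly c p) m ≡ bound c (evalPoly p m)
boundPoly-correct (x ≔ e) p m rewrite *-zeroʳ m = +-identityʳ _
boundPoly-correct (c ⨾ d) p m
  rewrite evalPoly-⊕ (1 ∷ []) (boundPoly c p ⊕ boundPoly d p) m | *-zeroʳ m
        | evalPoly-⊕ (boundPoly c p) (boundPoly d p) m
        | boundPoly-correct c p m | boundPoly-correct d p m = refl
boundPoly-correct (if e then c else d) p m
  rewrite evalPoly-⊕ (suc (cost e) ∷ []) (boundPoly c p ⊕ boundPoly d p) m | *-zeroʳ m
        | evalPoly-⊕ (boundPoly c p) (boundPoly d p) m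
        | boundPoly-correct c p m | boundPoly-correct d p m | +-identityʳ (cost e) = refl
boundPoly-correct (while e loop c) p m
  rewrite evalPoly-⊕ (suc (cost e) ∷ []) (p ⊗ ((suc (cost e) ∷ []) ⊕ boundPoly c p)) m | *-zeroʳ m
        | evalPoly-⊗ p ((suc (cost e) ∷ []) ⊕ boundPoly c p) m
        | evalPoly-⊕ (suc (cost e) ∷ []) (boundPoly c p) m | *-zeroʳ m
        | boundPoly-correct c p m | +-identityʳ (cost e) = refl

-- Simplification of circuits under partial assignments

Literal : Set
Literal = Bool × ℕ

-- What is known about a wire under a partial assignment: its value, or that it
-- carries, possibly negated, the value of an unassigned input or surviving gate.
data Abs : Set where
  const : Bool → Abs
  lit   : Literal → Abs

flipped : Abs → Abs
flipped (const b)     = const (not b)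
flipped (lit (p , i)) = lit (not p , i)

signed : Bool → Abs → Abs
signed true  a = a
signed false a = flipped a

_⟨_⟩ : (ℕ → Abs) → Abs → Abs
θ ⟨ const b ⟩     = const b
θ ⟨ lit (p , i) ⟩ = signed p (θ i)

-- A gate either collapses to something known about earlier wires or survives as a conjunction of
-- two literals.
Reduct : Set
Reduct = Abs ⊎ (Literal × Literal)

meetEqual : Bool → Bool → ℕ → Abs
meetEqual true  true  i = lit (true , i)
meetEqual false false i = lit (false , i)
meetEqual true  false i = const false
meetEqual false true  i = const false

meet : Abs → Abs → Reduct
meet (const false)   b             = inj₁ (const false)
meet (const true)    b             = inj₁ b
meet (lit l)         (const false) = inj₁ (const false)
meet (lit l)         (const true)  = inj₁ (lit l)
meet (lit (p , i))   (lit (q , j)) with i ≟ j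
... | yes _ = inj₁ (meetEqual p q i)
... | no  _ = inj₂ ((p , i) , (q , j))

meet-kept : ∀ a b {l m} → meet a b ≡ inj₂ (l , m) →
  a ≡ lit l × b ≡ lit m × proj₂ l ≢ proj₂ m
meet-kept (const false) b ()
meet-kept (const true) b ()
meet-kept (lit l) (const false) ()
meet-kept (lit l) (const true) ()
meet-kept (lit (p , i)) (lit (q , j)) eq with i ≟ j
meet-kept (lit (p , i)) (lit (q , j)) refl | no i≢j = refl , refl , i≢j

meet-falseʳ : ∀ a → meet a (const false) ≡ inj₁ (const false)
meet-falseʳ (const false) = refl
meet-falseʳ (const true)  = refl
meet-falseʳ (lit _)       = refl

meet-trueʳ : ∀ a → meet a (const true) ≡ inj₁ a
meet-trueʳ (const false) = refl
meet-trueʳ (const true)  = refl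
meet-trueʳ (lit _)       = refl

meet-constʳ : ∀ a b → ∃ λ d → meet a (const b) ≡ inj₁ d
meet-constʳ a false = _ , meet-falseʳ a
meet-constʳ a true  = _ , meet-trueʳ a

meet-same : ∀ a → meet a a ≡ inj₁ a
meet-same (const false) = refl
meet-same (const true)  = refl
meet-same (lit (p , i)) with i ≟ i
... | no i≢i = contradiction refl i≢i
meet-same (lit (true  , i)) | yes _ = refl
meet-same (lit (false , i)) | yes _ = refl

meet-flippedʳ : ∀ a → meet a (flipped a) ≡ inj₁ (const false)
meet-flippedʳ (const false) = refl
meet-flippedʳ (const true)  = refl
meet-flippedʳ (lit (p , i)) with i ≟ i
... | no i≢i = contradiction refl i≢i
meet-flippedʳ (lit (true  , i)) | yes _ = refl
meet-flippedʳ (lit (false , i)) | yes _ = refl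

meet-flippedˡ : ∀ a → meet (flipped a) a ≡ inj₁ (const false)
meet-flippedˡ (const false) = refl
meet-flippedˡ (const true)  = refl
meet-flippedˡ (lit (p , i)) with i ≟ i
... | no i≢i = contradiction refl i≢i
meet-flippedˡ (lit (true  , i)) | yes _ = refl
meet-flippedˡ (lit (false , i)) | yes _ = refl

-- Every rule that makes a conjunction collapse (a constant operand, idempotence, contradiction)
-- remains valid when arbitrary values are substituted for the wires.
meet-stable : ∀ θ a b {d} → meet a b ≡ inj₁ d → meet (θ ⟨ a ⟩) (θ ⟨ b ⟩) ≡ inj₁ (θ ⟨ d ⟩)
meet-stable θ (const false) b             refl = refl
meet-stable θ (const true)  b             refl = refl
meet-stable θ a@(lit (_ , _)) (const false) refl = meet-falseʳ (θ ⟨ a ⟩)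
meet-stable θ a@(lit (_ , _)) (const true)  refl = meet-trueʳ (θ ⟨ a ⟩)
meet-stable θ (lit (p , i)) (lit (q , j)) eq with i ≟ j
meet-stable θ (lit (true  , i)) (lit (true  , i)) refl | yes refl = meet-same (θ i)
meet-stable θ (lit (true  , i)) (lit (false , i)) refl | yes refl = meet-flippedʳ (θ i)
meet-stable θ (lit (false , i)) (lit (true  , i)) refl | yes refl = meet-flippedˡ (θ i)
meet-stable θ (lit (false , i)) (lit (false , i)) refl | yes refl = meet-same (flipped (θ i))

flipped-stable : ∀ θ a → θ ⟨ flipped a ⟩ ≡ flipped (θ ⟨ a ⟩)
flipped-stable θ (const b) = refl
flipped-stable θ (lit (true  , i)) = refl
flipped-stable θ (lit (false , i)) with θ i
... | const false = refl
... | const true = refl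
... | lit (false , j) = refl
... | lit (true , j) = refl

signed-stable : ∀ θ p a → θ ⟨ signed p a ⟩ ≡ signed p (θ ⟨ a ⟩)
signed-stable θ true  a = refl
signed-stable θ false a = flipped-stable θ a

-- By De Morgan's laws a gate is a conjunction of literals up to the sign of its
-- result, so that a surviving gate is described by two literals.
polarity : ∀ {w} → Gate w → Bool
polarity (const _) = true
polarity (neg _)   = false
polarity (and _ _) = true
polarity (or _ _)  = false

reduct : ∀ {w} → Gate w → Vec Abs w → Reduct
reduct (const b) ρ = inj₁ (const b)
reduct (neg i)   ρ = inj₁ (lookup ρ i)
reduct (and i j) ρ = meet (lookup ρ i) (lookup ρ j)
reduct (or i j)  ρ = meet (flipped (lookup ρ i)) (flipped (lookup ρ j))

result : ℕ → Reduct → Abs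
result w (inj₁ a) = a
result w (inj₂ _) = lit (true , w)

gateAbs : ∀ {w} → Gate w → Vec Abs w → Abs
gateAbs {w} g ρ = signed (polarity g) (result w (reduct g ρ))

Node : Set
Node = ℕ × Literal × Literal

addNode : ℕ → Reduct → List Node → List Node
addNode w (inj₁ _) ns = ns
addNode w (inj₂ n) ns = (w , n) ∷ ns

nodes : ∀ {w} → Circuit w → Vec Abs w → List Node
nodes (output i)  ρ = []
nodes {w} (g ▷ C) ρ = addNode w (reduct g ρ) (nodes C (gateAbs g ρ ∷ ρ))

out : ∀ {w} → Circuit w → Vec Abs w → Abs
out (output i) ρ = lookup ρ i
out (g ▷ C)    ρ = out C (gateAbs g ρ ∷ ρ)

count : ∀ {w} → Circuit w → Vec Abs w → ℕ
count C ρ = length (nodes C ρ)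

gateAbs-const : ∀ {w} (g : Gate w) x → gateAbs g (Vec.map const x) ≡ const (evalGate g x)
gateAbs-const (const b) x = refl
gateAbs-const (neg i)   x rewrite lookup-map i Abs.const x = refl
gateAbs-const (and i j) x rewrite lookup-map i Abs.const x | lookup-map j Abs.const x
  with lookup x i
... | false = refl
... | true  = refl
gateAbs-const (or i j) x rewrite lookup-map i Abs.const x | lookup-map j Abs.const x
  with lookup x i | lookup x j
... | false | false = refl
... | false | true  = refl
... | true  | _     = refl

out-const : ∀ {w} (C : Circuit w) x → out C (Vec.map const x) ≡ const (eval C x)
out-const (output i) x = lookup-map i const x
out-const (g ▷ C)    x rewrite gateAbs-const g x = out-const C (evalGate g x ∷ x)

count-addNode : ∀ w r ns → length (addNode w r ns) ≤ suc (length ns)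
count-addNode w (inj₁ _) ns = n≤1+n _
count-addNode w (inj₂ _) ns = ≤-refl

count≤size : ∀ {w} (C : Circuit w) ρ → count C ρ ≤ size C
count≤size (output _)    ρ = z≤n
count≤size (const _ ▷ C) ρ = count≤size C _
count≤size (neg _ ▷ C)   ρ = count≤size C _
count≤size (g@(and _ _) ▷ C) ρ = ≤-trans (count-addNode _ (reduct g ρ) _) (s≤s (count≤size C _))
count≤size (g@(or _ _)  ▷ C) ρ = ≤-trans (count-addNode _ (reduct g ρ) _) (s≤s (count≤size C _))

On : (ℕ → Set) → Abs → Set
On P (const _)     = ⊤
On P (lit (_ , i)) = P i

EnvOn : (ℕ → Set) → ∀ {w} → Vec Abs w → Set
EnvOn P ρ = ∀ x → On P (lookup ρ x)

module _ {P : ℕ → Set} where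

  On-flipped : ∀ a → On P a → On P (flipped a)
  On-flipped (const _) _ = tt
  On-flipped (lit _)   h = h

  On-signed : ∀ p a → On P a → On P (signed p a)
  On-signed true  a h = h
  On-signed false a h = On-flipped a h

  On-map : ∀ {Q : ℕ → Set} → (∀ {k} → P k → Q k) → ∀ a → On P a → On Q a
  On-map P⊆Q (const _) _ = tt
  On-map P⊆Q (lit _)   h = P⊆Q h

  EnvOn-∷ : ∀ {w a} {ρ : Vec Abs w} → On P a → EnvOn P ρ → EnvOn P (a ∷ ρ)
  EnvOn-∷ h hs zero    = h
  EnvOn-∷ h hs (suc x) = hs x

  meet-On : ∀ a b {d} → meet a b ≡ inj₁ d → On P a → On P b → On P d
  meet-On (const false) b refl ha hb = tt
  meet-On (const true)  b refl ha hb = hb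
  meet-On (lit _) (const false) refl ha hb = tt
  meet-On (lit _) (const true)  refl ha hb = ha
  meet-On (lit (p , i)) (lit (q , j)) eq ha hb with i ≟ j
  meet-On (lit (true  , i)) (lit (true  , i)) refl ha hb | yes refl = ha
  meet-On (lit (true  , i)) (lit (false , i)) refl ha hb | yes refl = tt
  meet-On (lit (false , i)) (lit (true  , i)) refl ha hb | yes refl = tt
  meet-On (lit (false , i)) (lit (false , i)) refl ha hb | yes refl = ha

  reduct-On : ∀ {w} (g : Gate w) ρ {d} → reduct g ρ ≡ inj₁ d → EnvOn P ρ → On P d
  reduct-On (const b) ρ refl hs = tt
  reduct-On (neg i)   ρ refl hs = hs i
  reduct-On (and i j) ρ eq   hs = meet-On (lookup ρ i) (lookup ρ j) eq (hs i) (hs j)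
  reduct-On (or i j)  ρ eq   hs =
    meet-On (flipped (lookup ρ i)) (flipped (lookup ρ j)) eq
      (On-flipped (lookup ρ i) (hs i)) (On-flipped (lookup ρ j) (hs j))

  meet-kept-On : ∀ a b {l m} → meet a b ≡ inj₂ (l , m) → On P a → On P b →
    P (proj₂ l) × P (proj₂ m)
  meet-kept-On a b eq ha hb with meet-kept a b eq
  ... | refl , refl , _ = ha , hb

  reduct-kept-On : ∀ {w} (g : Gate w) ρ {l m} → reduct g ρ ≡ inj₂ (l , m) → EnvOn P ρ →
    P (proj₂ l) × P (proj₂ m)
  reduct-kept-On (and i j) ρ eq hs = meet-kept-On (lookup ρ i) (lookup ρ j) eq (hs i) (hs j)
  reduct-kept-On (or i j)  ρ eq hs =
    meet-kept-On (flipped (lookup ρ i)) (flipped (lookup ρ j)) eq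
      (On-flipped (lookup ρ i) (hs i)) (On-flipped (lookup ρ j) (hs j))

reduct-kept-distinct : ∀ {w} (g : Gate w) ρ {l m} → reduct g ρ ≡ inj₂ (l , m) →
  proj₂ l ≢ proj₂ m
reduct-kept-distinct (and i j) ρ eq = meet-kept (lookup ρ i) (lookup ρ j) eq .proj₂ .proj₂
reduct-kept-distinct (or i j)  ρ eq =
  meet-kept (flipped (lookup ρ i)) (flipped (lookup ρ j)) eq .proj₂ .proj₂

Uses : Node → ℕ → Set
Uses (_ , (_ , i) , (_ , j)) k = k ≡ i ⊎ k ≡ j

Known : (ℕ → Set) → List Node → ℕ → Set
Known P ns k = P k ⊎ ∃ λ n → (k , n) ∈ ns

-- What gate elimination has to know about the shape of a simplified circuit, so that it can work
-- with a bare list of nodes. `P` tells which numbers belong to free inputs.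
record WellFormed (P : ℕ → Set) (w : ℕ) (ns : List Node) (o : Abs) : Set where
  field
    distinct : ∀ {k p i q j} → (k , (p , i) , (q , j)) ∈ ns → i ≢ j
    earlier  : ∀ {ν k} → ν ∈ ns → Uses ν k → k < proj₁ ν
    fresh    : ∀ {ν} → ν ∈ ns → w ≤ proj₁ ν
    unique   : ∀ {ν μ} → ν ∈ ns → μ ∈ ns → proj₁ ν ≡ proj₁ μ → ν ≡ μ
    known    : ∀ {ν k} → ν ∈ ns → Uses ν k → Known P ns k
    out-known : On (Known P ns) o

wellFormed : ∀ {P w} (C : Circuit w) ρ → EnvOn P ρ → (∀ {k} → P k → k < w) →
  WellFormed P w (nodes C ρ) (out C ρ)
wellFormed (output i) ρ hs P<w = record
  { distinct = λ () ; earlier = λ () ; fresh = λ () ; unique = λ () ; known = λ ()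
  ; out-known = On-map inj₁ (lookup ρ i) (hs i) }
wellFormed {P} {w} (g ▷ C) ρ hs P<w with reduct g ρ in eq
... | inj₁ d = record
  { distinct = distinct ih ; earlier = earlier ih ; fresh = λ ν∈ → <⇒≤ (fresh ih ν∈)
  ; unique = unique ih ; known = known ih ; out-known = out-known ih }
  where
  open WellFormed
  ih : WellFormed P (suc w) _ _
  ih = wellFormed C _ (EnvOn-∷ (On-signed (polarity g) d (reduct-On g ρ eq hs)) hs)
    (λ h → m<n⇒m<1+n (P<w h))
... | inj₂ (l , m) = record
  { distinct = λ { (here refl) → reduct-kept-distinct g ρ eq ; (there ν∈) → distinct ih ν∈ }
  ; earlier = λ { (here refl) (inj₁ refl) → P<w Pl ; (here refl) (inj₂ refl) → P<w Pm
                ; (there ν∈) u → earlier ih ν∈ u }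
  ; fresh = λ { (here refl) → ≤-refl ; (there ν∈) → <⇒≤ (fresh ih ν∈) }
  ; unique = λ { (here refl) (here refl) _ → refl
               ; (here refl) (there μ∈) w≡ → contradiction w≡ (<⇒≢ (fresh ih μ∈))
               ; (there ν∈) (here refl) ≡w → contradiction (sym ≡w) (<⇒≢ (fresh ih ν∈))
               ; (there ν∈) (there μ∈) e → unique ih ν∈ μ∈ e }
  ; known = λ { (here refl) (inj₁ refl) → inj₁ Pl ; (here refl) (inj₂ refl) → inj₁ Pm
              ; (there ν∈) u → weaken (known ih ν∈ u) }
  ; out-known = On-map weaken (out C ρ′) (out-known ih) }
  where
  open WellFormed
  -- For the rest of the circuit the surviving gate is one more input; `weaken` turns it back into a
  -- node.
  P′ : ℕ → Set
  P′ k = P k ⊎ k ≡ w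
  ρ′ = signed (polarity g) (lit (true , w)) ∷ ρ
  ih : WellFormed P′ (suc w) _ _
  ih = wellFormed C ρ′
    (EnvOn-∷ (On-signed (polarity g) (lit (true , w)) (inj₂ refl))
      (λ x → On-map inj₁ (lookup ρ x) (hs x)))
    [ (λ h → m<n⇒m<1+n (P<w h)) , (λ { refl → ≤-refl }) ]′
  Pl = reduct-kept-On g ρ eq hs .proj₁
  Pm = reduct-kept-On g ρ eq hs .proj₂
  weaken : ∀ {k} → Known P′ (nodes C ρ′) k → Known P ((w , l , m) ∷ nodes C ρ′) k
  weaken (inj₁ (inj₁ h))    = inj₁ h
  weaken (inj₁ (inj₂ refl)) = inj₂ (_ , here refl)
  weaken (inj₂ (n , k∈))    = inj₂ (n , there k∈)

-- Further restriction of a simplified circuit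

reduce : (ℕ → Abs) → Literal × Literal → Reduct
reduce θ (l , m) = meet (θ ⟨ lit l ⟩) (θ ⟨ lit m ⟩)

weight : Reduct → ℕ
weight (inj₁ _) = 0
weight (inj₂ _) = 1

survivors : (ℕ → Abs) → List Node → ℕ
survivors θ []             = 0
survivors θ ((_ , n) ∷ ns) = weight (reduce θ n) + survivors θ ns

-- θ gives every surviving gate the value that simplification under θ does.
Solves : (ℕ → Abs) → List Node → Set
Solves θ ns = ∀ {k n} → (k , n) ∈ ns → θ k ≡ result k (reduce θ n)

reduct-stable : ∀ {w} θ (g : Gate w) ρ {d} → reduct g ρ ≡ inj₁ d →
  reduct g (Vec.map (θ ⟨_⟩) ρ) ≡ inj₁ (θ ⟨ d ⟩)
reduct-stable θ (const b) ρ refl = refl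
reduct-stable θ (neg i)   ρ refl = cong inj₁ (lookup-map i (θ ⟨_⟩) ρ)
reduct-stable θ (and i j) ρ eq
  rewrite lookup-map i (θ ⟨_⟩) ρ | lookup-map j (θ ⟨_⟩) ρ = meet-stable θ (lookup ρ i) (lookup ρ j) eq
reduct-stable θ (or i j)  ρ eq
  rewrite lookup-map i (θ ⟨_⟩) ρ | lookup-map j (θ ⟨_⟩) ρ
        | sym (flipped-stable θ (lookup ρ i)) | sym (flipped-stable θ (lookup ρ j)) =
  meet-stable θ (flipped (lookup ρ i)) (flipped (lookup ρ j)) eq

meet-reduce : ∀ θ a b {n} → meet a b ≡ inj₂ n → meet (θ ⟨ a ⟩) (θ ⟨ b ⟩) ≡ reduce θ n
meet-reduce θ a b eq with meet-kept a b eq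
... | refl , refl , _ = refl

reduct-reduce : ∀ {w} θ (g : Gate w) ρ {n} → reduct g ρ ≡ inj₂ n →
  reduct g (Vec.map (θ ⟨_⟩) ρ) ≡ reduce θ n
reduct-reduce θ (and i j) ρ eq
  rewrite lookup-map i (θ ⟨_⟩) ρ | lookup-map j (θ ⟨_⟩) ρ = meet-reduce θ (lookup ρ i) (lookup ρ j) eq
reduct-reduce θ (or i j)  ρ eq
  rewrite lookup-map i (θ ⟨_⟩) ρ | lookup-map j (θ ⟨_⟩) ρ
        | sym (flipped-stable θ (lookup ρ i)) | sym (flipped-stable θ (lookup ρ j)) =
  meet-reduce θ (flipped (lookup ρ i)) (flipped (lookup ρ j)) eq

_[_↦_] : (ℕ → Abs) → ℕ → Abs → ℕ → Abs
(θ [ w ↦ a ]) k with k ≟ w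
... | yes _ = a
... | no  _ = θ k

update-at : ∀ θ w a → (θ [ w ↦ a ]) w ≡ a
update-at θ w a with w ≟ w
... | yes _   = refl
... | no  w≢w = contradiction refl w≢w

update-below : ∀ θ w a {k} → k < w → (θ [ w ↦ a ]) k ≡ θ k
update-below θ w a {k} k<w with k ≟ w
... | yes refl = contradiction k<w (<-irrefl refl)
... | no  _    = refl

⟨⟩-cong : ∀ {P θ θ′} → (∀ {k} → P k → θ k ≡ θ′ k) → ∀ a → On P a → θ ⟨ a ⟩ ≡ θ′ ⟨ a ⟩
⟨⟩-cong θ≗θ′ (const b)     h = refl
⟨⟩-cong θ≗θ′ (lit (p , i)) h = cong (signed p) (θ≗θ′ h)

map-⟨⟩-cong : ∀ {P θ θ′ w} → (∀ {k} → P k → θ k ≡ θ′ k) → (ρ : Vec Abs w) → EnvOn P ρ →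
  Vec.map (θ ⟨_⟩) ρ ≡ Vec.map (θ′ ⟨_⟩) ρ
map-⟨⟩-cong θ≗θ′ []      hs = refl
map-⟨⟩-cong θ≗θ′ (a ∷ ρ) hs =
  cong₂ _∷_ (⟨⟩-cong θ≗θ′ a (hs zero)) (map-⟨⟩-cong θ≗θ′ ρ (hs ∘ suc))

-- The circuit (ns , o) simplifies under θ to one with c gates and output o′.
record Restriction (w : ℕ) (θ : ℕ → Abs) (ns : List Node) (o o′ : Abs) (c : ℕ) : Set where
  field
    solution  : ℕ → Abs
    extends   : ∀ {k} → k < w → solution k ≡ θ k
    solves    : Solves solution ns
    out≡      : o′ ≡ solution ⟨ o ⟩
    count≡    : c ≡ survivors solution ns

-- Simplifying `C` afresh under the refined environment agrees with simplifying what was left of it: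
-- a collapsed gate stays collapsed (`reduct-stable`) and a survivor reduces to the same thing
-- (`reduct-reduce`). So gate counts of two separate simplifications can be compared node by node.
restriction : ∀ {w} (C : Circuit w) ρ θ → EnvOn (_< w) ρ →
  let ρ′ = Vec.map (θ ⟨_⟩) ρ in
  Restriction w θ (nodes C ρ) (out C ρ) (out C ρ′) (count C ρ′)
restriction (output i) ρ θ hs = record
  { solution = θ ; extends = λ _ → refl ; solves = λ () ; out≡ = lookup-map i (θ ⟨_⟩) ρ
  ; count≡ = refl }
restriction {w} (g ▷ C) ρ θ hs with reduct g ρ in eq
... | inj₁ d rewrite reduct-stable θ g ρ eq | sym (signed-stable θ (polarity g) d) = record
  { solution = solution ih ; extends = λ k<w → extends ih (m<n⇒m<1+n k<w)
  ; solves = solves ih ; out≡ = out≡ ih ; count≡ = count≡ ih }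
  where
  open Restriction
  ih = restriction C (signed (polarity g) d ∷ ρ) θ
    (EnvOn-∷ (On-signed (polarity g) d (On-map m<n⇒m<1+n d (reduct-On g ρ eq hs)))
      (λ x → On-map m<n⇒m<1+n (lookup ρ x) (hs x)))
... | inj₂ n@((p , i) , (q , j)) = record
  { solution = solution ih
  ; extends = extends′
  ; solves = λ { (here refl) → trans (extends ih ≤-refl) (trans (update-at θ w _)
                   (cong (result w) (sym reduce≡)))
               ; (there ν∈) → solves ih ν∈ }
  ; out≡ = trans (cong (out C) (sym env≡)) (out≡ ih)
  ; count≡ = trans (count-step (reduct g (Vec.map (θ ⟨_⟩) ρ)) _)
      (cong₂ (λ r k → weight r + k) (trans (reduct-reduce θ g ρ eq) (sym reduce≡))
        (trans (cong (count C) (sym env≡)) (count≡ ih))) }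
  where
  open Restriction
  -- The number of the gate receives the outcome of the gate. As `w` exceeds all numbers in `ρ`,
  -- nothing known so far changes.
  θ₁ = θ [ w ↦ result w (reduce θ n) ]
  a = signed (polarity g) (lit (true , w))
  hs′ : EnvOn (_< suc w) (a ∷ ρ)
  hs′ = EnvOn-∷ (On-signed (polarity g) (lit (true , w)) ≤-refl)
      (λ x → On-map m<n⇒m<1+n (lookup ρ x) (hs x))
  ih = restriction C (a ∷ ρ) θ₁ hs′
  extends′ : ∀ {k} → k < w → solution ih k ≡ θ k
  extends′ k<w = trans (extends ih (m<n⇒m<1+n k<w)) (update-below θ w _ k<w)
  i<w = reduct-kept-On g ρ eq hs .proj₁
  j<w = reduct-kept-On g ρ eq hs .proj₂
  reduce≡ : reduce (solution ih) n ≡ reduce θ n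
  reduce≡ = cong₂ meet (cong (signed p) (extends′ i<w)) (cong (signed q) (extends′ j<w))
  env≡ : Vec.map (θ₁ ⟨_⟩) (a ∷ ρ) ≡ gateAbs g (Vec.map (θ ⟨_⟩) ρ) ∷ Vec.map (θ ⟨_⟩) ρ
  env≡ = cong₂ _∷_
    (trans (signed-stable θ₁ (polarity g) (lit (true , w)))
      (cong (signed (polarity g)) (trans (update-at θ w _)
        (cong (result w) (sym (reduct-reduce θ g ρ eq))))))
    (map-⟨⟩-cong (update-below θ w _) ρ hs)
  count-step : ∀ r ns → length (addNode w r ns) ≡ weight r + length ns
  count-step (inj₁ _) ns = refl
  count-step (inj₂ _) ns = refl

-- Gate elimination

survivors-++ : ∀ θ ns ms → survivors θ (ns ++ ms) ≡ survivors θ ns + survivors θ ms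
survivors-++ θ []             ms = refl
survivors-++ θ ((_ , n) ∷ ns) ms =
  trans (cong (weight (reduce θ n) +_) (survivors-++ θ ns ms))
    (sym (+-assoc (weight (reduce θ n)) _ _))

survivors≤length : ∀ θ ns → survivors θ ns ≤ length ns
survivors≤length θ []             = z≤n
survivors≤length θ ((_ , n) ∷ ns) with reduce θ n
... | inj₁ _ = m≤n⇒m≤1+n (survivors≤length θ ns)
... | inj₂ _ = s≤s (survivors≤length θ ns)

Killed : (ℕ → Abs) → Node → Set
Killed θ (_ , n) = ∃ λ d → reduce θ n ≡ inj₁ d

-- Each killed node is cut out of the list in turn; distinctness ensures that the remaining killed
-- nodes are still in it.
survivors+killed≤length : ∀ θ {ns} κs → Unique κs → All (λ κ → κ ∈ ns × Killed θ κ) κs →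
  survivors θ ns + length κs ≤ length ns
survivors+killed≤length θ {ns} []       _         _ =
  subst (_≤ length ns) (sym (+-identityʳ _)) (survivors≤length θ ns)
survivors+killed≤length θ {ns} (κ ∷ κs) (κ∉ ∷ u) ((κ∈ , d , eq) ∷ ks) with ∈-∃++ κ∈
... | as , bs , refl = begin
  survivors θ (as ++ κ ∷ bs) + suc (length κs)
    ≡⟨ cong (_+ suc (length κs)) (survivors-++ θ as (κ ∷ bs)) ⟩
  survivors θ as + (weight (reduce θ (proj₂ κ)) + survivors θ bs) + suc (length κs)
    ≡⟨ cong (λ r → survivors θ as + (weight r + survivors θ bs) + suc (length κs)) eq ⟩
  survivors θ as + survivors θ bs + suc (length κs)
    ≡⟨ cong (_+ suc (length κs)) (survivors-++ θ as bs) ⟨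
  survivors θ (as ++ bs) + suc (length κs)
    ≡⟨ +-suc _ _ ⟩
  suc (survivors θ (as ++ bs) + length κs)
    ≤⟨ s≤s (survivors+killed≤length θ κs u (All.zipWith keep (κ∉ , ks))) ⟩
  suc (length (as ++ bs))
    ≡⟨ cong suc (length-++ as) ⟩
  suc (length as + length bs)
    ≡⟨ +-suc _ _ ⟨
  length as + suc (length bs)
    ≡⟨ length-++ as ⟨
  length (as ++ κ ∷ bs) ∎
  where
  open ≤-Reasoning
  keep : ∀ {μ} → κ ≢ μ × μ ∈ as ++ κ ∷ bs × Killed θ μ → μ ∈ as ++ bs × Killed θ μ
  keep (κ≢μ , μ∈ , k) with ∈-++⁻ as μ∈
  ... | inj₁ μ∈as          = ∈-++⁺ˡ μ∈as , k
  ... | inj₂ (here refl)   = contradiction refl κ≢μ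
  ... | inj₂ (there μ∈bs)  = ∈-++⁺ʳ as μ∈bs , k

signed-const : ∀ p b → ∃ λ d → signed p (const b) ≡ const d
signed-const true  b = _ , refl
signed-const false b = _ , refl

signed-not : ∀ p → signed p (const (not p)) ≡ const false
signed-not true  = refl
signed-not false = refl

Fixed : (ℕ → Abs) → ℕ → Set
Fixed θ k = ∃ λ b → θ k ≡ const b

uses⇒killed : ∀ {θ k} ν → Uses ν k → Fixed θ k → Killed θ ν
uses⇒killed {θ} (_ , (p , i) , (q , j)) (inj₁ refl) (b , eq) rewrite eq with signed-const p b
... | false , eq′ rewrite eq′ = _ , refl
... | true  , eq′ rewrite eq′ = _ , refl
uses⇒killed {θ} (_ , (p , i) , (q , j)) (inj₂ refl) (b , eq) rewrite eq with signed-const q b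
... | d , eq′ rewrite eq′ = meet-constʳ (signed p (θ i)) d

module _ {θ ns} (solves : Solves θ ns) where

  falseˡ : ∀ {k p i m} → (k , (p , i) , m) ∈ ns → θ i ≡ const (not p) → θ k ≡ const false
  falseˡ {k} {p} {i} ν∈ eq rewrite solves ν∈ | eq | signed-not p = refl

  falseʳ : ∀ {k l q j} → (k , l , (q , j)) ∈ ns → θ j ≡ const (not q) → θ k ≡ const false
  falseʳ {k} {l} {q} {j} ν∈ eq
    rewrite solves ν∈ | eq | signed-not q | meet-falseʳ (θ ⟨ lit l ⟩) = refl

  fixed : ∀ {ν} → ν ∈ ns → (∀ {k} → Uses ν k → Fixed θ k) → Fixed θ (proj₁ ν)
  fixed {_ , (p , i) , (q , j)} ν∈ h with h (inj₁ refl) | h (inj₂ refl)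
  ... | b , eq | c , eq′ with signed-const p b | signed-const q c
  ...   | false , e | d , e′ rewrite solves ν∈ | eq | eq′ | e = _ , refl
  ...   | true  , e | d , e′ rewrite solves ν∈ | eq | eq′ | e | e′ = _ , refl

agree : ∀ {θ θ′ ns} → Solves θ ns → Solves θ′ ns → ∀ {ν} → ν ∈ ns →
  (∀ {k} → Uses ν k → θ k ≡ θ′ k) → θ (proj₁ ν) ≡ θ′ (proj₁ ν)
agree s s′ {k , (p , i) , (q , j)} ν∈ h =
  trans (s ν∈) (trans (cong₂ (λ a b → result k (meet (signed p a) (signed q b)))
    (h (inj₁ refl)) (h (inj₂ refl))) (sym (s′ ν∈)))

-- In sensitive, θ and θ′ come from two inputs that differ at i only.
module Elimination
  {P w ns o} (wf : WellFormed P w ns o) (P<w : ∀ {k} → P k → k < w)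
  (two : ∃₂ λ i j → P i × P j × i ≢ j)
  (sensitive : ∀ {i j} → P i → P j → i ≢ j → ∀ c → ∃₂ λ θ θ′ →
    Solves θ ns × Solves θ′ ns × (∀ {k} → P k → k ≢ i → θ k ≡ θ′ k) ×
    θ j ≡ const c × θ ⟨ o ⟩ ≢ θ′ ⟨ o ⟩)
  (stuck : ∀ {i} → P i → ∀ c → ∃ λ θ → Solves θ ns × θ i ≡ const c ×
    ¬ (survivors θ ns + 3 ≤ length ns))
  where

  open WellFormed wf

  -- Liveness provides what comes after a gate: a live reader, which can be removed as well, or else
  -- the output, where `sensitive` gives the contradiction.
  data Live (k : ℕ) : Set where
    top : ∀ {p} → o ≡ lit (p , k) → Live k
    via : ∀ {ν} → ν ∈ ns → Uses ν k → Live (proj₁ ν) → Live k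

  out-agree : ∀ {θ θ′ : ℕ → Abs} {p k} → o ≡ lit (p , k) → θ k ≡ θ′ k → θ ⟨ o ⟩ ≡ θ′ ⟨ o ⟩
  out-agree {p = p} refl eq = cong (signed p) eq

  module _ {γ i j} (γ∈ : γ ∈ ns) (Pi : P i) (Pj : P j)
    (γ-uses-i : Uses γ i) (i≢j : i ≢ j)
    (c : Bool) (falsifies : ∀ {θ} → Solves θ ns → θ i ≡ const c → θ (proj₁ γ) ≡ const false)
    where

    private
      j≢i : j ≢ i
      j≢i = i≢j ∘ sym

      γ>i : i < proj₁ γ
      γ>i = earlier γ∈ γ-uses-i

    three-killed : ∀ {θ} → ¬ (survivors θ ns + 3 ≤ length ns) → ∀ {η π} → η ∈ ns → π ∈ ns →
      γ ≢ η → γ ≢ π → η ≢ π → Killed θ γ → Killed θ η → Killed θ π → ⊥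
    three-killed {θ} ¬3 {η} {π} η∈ π∈ γ≢η γ≢π η≢π γk ηk πk =
      ¬3 (survivors+killed≤length θ (γ ∷ η ∷ π ∷ [])
        ((γ≢η ∷ γ≢π ∷ []) ∷ (η≢π ∷ []) ∷ [] ∷ [])
        ((γ∈ , γk) ∷ (η∈ , ηk) ∷ (π∈ , πk) ∷ []))

    no-other-use : Live (proj₁ γ) → ∀ {η} → η ∈ ns → Uses η i → γ ≢ η → ⊥
    -- If γ is the output, assigning `c` to `i` fixes the output, which can then no longer depend on
    -- `j`.
    no-other-use (top o≡) {η} η∈ η-uses-i γ≢η with sensitive Pj Pi j≢i c
    ... | θ , θ′ , s , s′ , same , θi , differ =
      differ (out-agree o≡ (trans (falsifies s θi) (sym (falsifies s′ θ′i))))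
      where
      θ′i = trans (sym (same Pi i≢j)) θi
    no-other-use (via {π} π∈ π-uses-γ π-live) {η} η∈ η-uses-i γ≢η with stuck Pi c
    ... | θ , s , θi , ¬3 with proj₁ π ≟ proj₁ η
    ...   | no π≢η =
      three-killed ¬3 η∈ π∈ γ≢η (λ { refl → <-irrefl refl (earlier π∈ π-uses-γ) })
        (λ { refl → π≢η refl })
        (uses⇒killed γ γ-uses-i (_ , θi)) (uses⇒killed η η-uses-i (_ , θi))
        (uses⇒killed π π-uses-γ (_ , falsifies s θi))
    ...   | yes π≡η with unique π∈ η∈ π≡η
    ...     | refl = η-case π-live
      where
      -- Assigning i fixes γ and hence both inputs of η.
      inputs : ∀ {k} → Uses η k → k ≡ i ⊎ k ≡ proj₁ γ
      inputs {k} u = only η-uses-i π-uses-γ u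
        where
        only : Uses η i → Uses η (proj₁ γ) → Uses η k → k ≡ i ⊎ k ≡ proj₁ γ
        only (inj₁ refl) (inj₁ e)    _           = contradiction γ>i (<-irrefl (sym e))
        only (inj₁ refl) (inj₂ refl) (inj₁ refl) = inj₁ refl
        only (inj₁ refl) (inj₂ refl) (inj₂ refl) = inj₂ refl
        only (inj₂ refl) (inj₁ refl) (inj₁ refl) = inj₂ refl
        only (inj₂ refl) (inj₁ refl) (inj₂ refl) = inj₁ refl
        only (inj₂ refl) (inj₂ e)    _           = contradiction γ>i (<-irrefl (sym e))

      η-case : Live (proj₁ η) → ⊥
      -- If η is the output, it is determined by `i` and γ, both fixed, and again cannot depend on
      -- `j`.
      η-case (top o≡) with sensitive Pj Pi j≢i c
      ... | θ , θ′ , s , s′ , same , θi , differ =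
        differ (out-agree o≡ (agree s s′ η∈ λ u → same′ (inputs u)))
        where
        θ′i = trans (sym (same Pi i≢j)) θi
        same′ : ∀ {k} → k ≡ i ⊎ k ≡ proj₁ γ → θ k ≡ θ′ k
        same′ (inj₁ refl) = same Pi i≢j
        same′ (inj₂ refl) = trans (falsifies s θi) (sym (falsifies s′ θ′i))
      η-case (via {μ} μ∈ μ-uses-η _) =
        three-killed ¬3 η∈ μ∈ γ≢η
          (λ { refl → <-asym (earlier π∈ π-uses-γ) (earlier μ∈ μ-uses-η) })
          (λ { refl → <-irrefl refl (earlier μ∈ μ-uses-η) })
          (uses⇒killed γ γ-uses-i (_ , θi)) (uses⇒killed η η-uses-i (_ , θi))
          (uses⇒killed μ μ-uses-η (fixed s η∈ λ u → fixes (inputs u)))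
        where
        fixes : ∀ {k} → k ≡ i ⊎ k ≡ proj₁ γ → Fixed θ k
        fixes (inj₁ refl) = _ , θi
        fixes (inj₂ refl) = _ , falsifies s θi

  -- i must feed a second gate, as otherwise falsifying γ by j hides i.
  first-gate : ∀ {k p i q j} → (k , (p , i) , (q , j)) ∈ ns → Live k → P i → P j →
    On (λ k → ¬ P k) o → ⊥
  first-gate {g} {p} {i} {q} {j} γ∈ live Pi Pj o-gate
    -- `not q` is the value of `j` that falsifies the literal `(q , j)` and with it γ.
    with sensitive Pi Pj (distinct γ∈) (not q)
  ... | θ , θ′ , s , s′ , same , θj , differ = differ (out-same o refl)
    where
    γ : Node
    γ = g , (p , i) , (q , j)
    i≢j = distinct γ∈
    θ′j = trans (sym (same Pj (i≢j ∘ sym))) θj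

    γ-only : ∀ {η} → η ∈ ns → Uses η i → γ ≢ η → ⊥
    γ-only = no-other-use γ∈ Pi Pj (inj₁ refl) i≢j (not p) (λ s θi → falseˡ s γ∈ θi) live

    -- Induction on wire numbers: γ is false on both sides, and by `γ-only` no other gate reads `i`,
    -- so a difference at `i` spreads nowhere.
    same-below : ∀ {k} → WF.Acc _<_ k → Known P ns k → k ≢ i → θ k ≡ θ′ k
    same-below _ (inj₁ Pk) k≢i = same Pk k≢i
    same-below {k} (WF.acc below) (inj₂ (n , η∈)) k≢i with k ≟ g
    ... | yes refl = trans (falseʳ s γ∈ θj) (sym (falseʳ s′ γ∈ θ′j))
    ... | no k≢g = agree s s′ η∈ λ u → same-below (below (earlier η∈ u)) (known η∈ u)
      λ { refl → γ-only η∈ u λ { refl → k≢g refl } }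

    out-same : ∀ a → o ≡ a → θ ⟨ o ⟩ ≡ θ′ ⟨ o ⟩
    out-same (const b)     refl = refl
    out-same (lit (r , k)) refl =
      cong (signed r) (same-below (<-wellFounded k) out-known λ { refl → o-gate Pi })

  -- Walking from a live gate to a gate that it reads keeps liveness and lowers the number, so the
  -- walk ends at a live gate with two free inputs.
  descend : ∀ {k n} → WF.Acc _<_ k → (k , n) ∈ ns → Live k → On (λ k → ¬ P k) o → ⊥
  descend {n = (p , i) , (q , j)} (WF.acc below) ν∈ live o-gate
    with known ν∈ (inj₁ refl) | known ν∈ (inj₂ refl)
  ... | inj₁ Pi        | inj₁ Pj        = first-gate ν∈ live Pi Pj o-gate
  ... | inj₂ (_ , μ∈) | _               =
    descend (below (earlier ν∈ (inj₁ refl))) μ∈ (via ν∈ (inj₁ refl) live) o-gate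
  ... | inj₁ _         | inj₂ (_ , μ∈) =
    descend (below (earlier ν∈ (inj₂ refl))) μ∈ (via ν∈ (inj₂ refl) live) o-gate

  impossible : ⊥
  impossible = by-output o refl two
    where
    by-output : ∀ a → o ≡ a → (∃₂ λ i j → P i × P j × i ≢ j) → ⊥
    by-output (const b) refl (i , j , Pi , Pj , i≢j) with sensitive Pi Pj i≢j true
    ... | _ , _ , _ , _ , _ , _ , differ = differ refl
    by-output (lit (p , k)) refl (i , j , Pi , Pj , i≢j) with out-known
    ... | inj₂ (n , ν∈) = descend (<-wellFounded k) ν∈ (top refl)
      λ Pk → <-irrefl refl (<-≤-trans (P<w Pk) (fresh ν∈))
    -- The output is a free input. Of the two inputs in `two`, at least one differs from `k`, and
    -- the output would ignore it.
    ... | inj₁ Pk with k ≟ i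
    ...   | yes refl with sensitive Pj Pi (i≢j ∘ sym) true
    ...     | _ , _ , _ , _ , same , _ , differ = differ (cong (signed p) (same Pk i≢j))
    by-output (lit (p , k)) refl (i , j , Pi , Pj , i≢j) | inj₁ Pk | no k≢i
      with sensitive Pi Pj i≢j true
    ... | _ , _ , _ , _ , same , _ , differ = differ (cong (signed p) (same Pk k≢i))

-- Partial assignments and candidate inputs

parity : ∀ {n} → Vec Bool n → Bool
parity []      = false
parity (b ∷ x) = b xor parity x

XOR-parity : ∀ {n} (x : Vec Bool n) → XOR x ≡ bit (parity x)
XOR-parity []      = refl
XOR-parity (b ∷ x) = begin
  (bit b + s) % 2            ≡⟨ %-distribˡ-+ (bit b) s 2 ⟩
  (bit b % 2 + s % 2) % 2    ≡⟨ cong (λ r → (bit b % 2 + r) % 2) (XOR-parity x) ⟩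
  (bit b % 2 + bit (parity x)) % 2  ≡⟨ table b (parity x) ⟩
  bit (b xor parity x)       ∎
  where
  open ≡-Reasoning
  s = Vec.sum (Vec.map bit x)
  table : ∀ b c → (bit b % 2 + bit c) % 2 ≡ bit (b xor c)
  table false false = refl
  table false true  = refl
  table true  false = refl
  table true  true  = refl

bit-injective : ∀ {b c} → bit b ≡ bit c → b ≡ c
bit-injective {false} {false} _ = refl
bit-injective {true}  {true}  _ = refl

lookup-ext : ∀ {A : Set} {n} {x y : Vec A n} → (∀ i → lookup x i ≡ lookup y i) → x ≡ y
lookup-ext {x = x} {y} eq =
  trans (sym (tabulate∘lookup x)) (trans (tabulate-cong eq) (tabulate∘lookup y))

parity-flip : ∀ {n} (x y : Vec Bool n) i → lookup x i ≢ lookup y i →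
  (∀ {j} → j ≢ i → lookup x j ≡ lookup y j) → parity x ≢ parity y
parity-flip (b ∷ x) (c ∷ y) zero b≢c eq
  rewrite lookup-ext {x = x} {y} (λ j → eq {suc j} λ ()) = table b c (parity y) b≢c
  where
  table : ∀ b c p → b ≢ c → b xor p ≢ c xor p
  table false false p b≢c = contradiction refl b≢c
  table true  true  p b≢c = contradiction refl b≢c
  table false true  false _ ()
  table false true  true  _ ()
  table true  false false _ ()
  table true  false true  _ ()
parity-flip (b ∷ x) (c ∷ y) (suc i) x≢y eq
  rewrite eq {zero} (λ ()) = λ p≡ →
    parity-flip x y i x≢y (λ j≢i → eq (j≢i ∘ Fin.suc-injective)) (xor-cancel c p≡)
  where
  xor-cancel : ∀ c {p q} → c xor p ≡ c xor q → p ≡ q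
  xor-cancel false eq = eq
  xor-cancel true  eq = not-injective eq

-- Inputs are numbered like gates: a wire's number is how many wires were there
-- before it.
level : ∀ {n} → Fin n → ℕ
level {suc n} zero    = n
level {suc n} (suc i) = level i

initial : ∀ n → Vec Abs n
initial zero    = []
initial (suc n) = lit (true , n) ∷ initial n

level<n : ∀ {n} (i : Fin n) → level i < n
level<n zero    = ≤-refl
level<n (suc i) = m<n⇒m<1+n (level<n i)

level-injective : ∀ {n} {i j : Fin n} → level i ≡ level j → i ≡ j
level-injective {i = zero}  {zero}  eq = refl
level-injective {i = zero}  {suc j} eq = contradiction (level<n j) (<-irrefl (sym eq))
level-injective {i = suc i} {zero}  eq = contradiction (level<n i) (<-irrefl eq)
level-injective {i = suc i} {suc j} eq = cong suc (level-injective eq)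

lookup-initial : ∀ {n} (i : Fin n) → lookup (initial n) i ≡ lit (true , level i)
lookup-initial {suc n} zero    = refl
lookup-initial {suc n} (suc i) = lookup-initial i

Free : ∀ {n} → Vec Abs n → Fin n → Set
Free ρ i = lookup ρ i ≡ lit (true , level i)

Partial : ∀ {n} → Vec Abs n → Set
Partial ρ = ∀ i → Free ρ i ⊎ ∃ λ b → lookup ρ i ≡ const b

FreeLevel : ∀ {n} → Vec Abs n → ℕ → Set
FreeLevel ρ k = ∃ λ i → k ≡ level i × Free ρ i

freeLevels : ∀ {n} (ρ : Vec Abs n) → Partial ρ → EnvOn (FreeLevel ρ) ρ
freeLevels ρ part i with part i
... | inj₁ free     rewrite free = i , refl , free
... | inj₂ (b , eq) rewrite eq   = tt

FreeLevel<n : ∀ {n} (ρ : Vec Abs n) {k} → FreeLevel ρ k → k < n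
FreeLevel<n ρ (i , refl , _) = level<n i

-- An environment read as a map on wire numbers; the default is reached only by numbers that belong
-- to no input.
at : ∀ {n} → Vec Abs n → ℕ → Abs
at []              k = const false
at {suc n} (a ∷ ρ) k with k ≟ n
... | yes _ = a
... | no  _ = at ρ k

at-level : ∀ {n} (ρ : Vec Abs n) i → at ρ (level i) ≡ lookup ρ i
at-level {suc n} (a ∷ ρ) zero with n ≟ n
... | yes _   = refl
... | no  n≢n = contradiction refl n≢n
at-level {suc n} (a ∷ ρ) (suc i) with level i ≟ n
... | yes eq = contradiction (level<n i) (<-irrefl eq)
... | no  _  = at-level ρ i

Refines : ∀ {n} → Vec Abs n → Vec Abs n → Set
Refines ρ ρ′ = ∀ i {b} → lookup ρ i ≡ const b → lookup ρ′ i ≡ const b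

-- A free entry of `ρ` is its own literal, for which the substitution puts the entry of `ρ′`. This
-- gives refinement the form that `restriction` asks for.
refine : ∀ {n} {ρ ρ′ : Vec Abs n} → Partial ρ → Refines ρ ρ′ → Vec.map (at ρ′ ⟨_⟩) ρ ≡ ρ′
refine {ρ = ρ} {ρ′} part ref = lookup-ext λ i → trans (lookup-map i (at ρ′ ⟨_⟩) ρ) (pointwise i)
  where
  pointwise : ∀ i → at ρ′ ⟨ lookup ρ i ⟩ ≡ lookup ρ′ i
  pointwise i with part i
  ... | inj₁ free     rewrite free = at-level ρ′ i
  ... | inj₂ (b , eq) rewrite eq   = sym (ref i eq)

refine-update : ∀ {n} (ρ : Vec Abs n) {i} c → Free ρ i → Refines ρ (ρ [ i ]≔ const c)
refine-update ρ {i} c free j eq with j Fin.≟ i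
... | yes refl with () ← trans (sym free) eq
... | no  j≢i  = trans (lookup∘update′ j≢i ρ (const c)) eq

bitOf : Abs → Bool
bitOf (const b) = b
bitOf (lit _)   = false

fill : ∀ {n} → Vec Abs n → Vec Bool n
fill = Vec.map bitOf

refine-fill : ∀ {n} (ρ : Vec Abs n) → Refines ρ (Vec.map const (fill ρ))
refine-fill ρ i eq =
  trans (lookup-map i const (fill ρ)) (cong const (trans (lookup-map i bitOf ρ) (cong bitOf eq)))

freeCount : ∀ {n} → Vec Abs n → ℕ
freeCount []            = 0
freeCount (const _ ∷ ρ) = freeCount ρ
freeCount (lit _ ∷ ρ)   = suc (freeCount ρ)

freeCount-initial : ∀ n → freeCount (initial n) ≡ n
freeCount-initial zero    = refl
freeCount-initial (suc n) = cong suc (freeCount-initial n)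

freeCount-update : ∀ {n} (ρ : Vec Abs n) i c → freeCount ρ ≤ suc (freeCount (ρ [ i ]≔ const c))
freeCount-update (const _ ∷ ρ) zero    c = n≤1+n _
freeCount-update (lit _ ∷ ρ)   zero    c = ≤-refl
freeCount-update (const _ ∷ ρ) (suc i) c = freeCount-update ρ i c
freeCount-update (lit _ ∷ ρ)   (suc i) c = s≤s (freeCount-update ρ i c)

IsLit : Abs → Set
IsLit a = ∃ λ l → a ≡ lit l

one-lit : ∀ {n} (ρ : Vec Abs n) → 1 ≤ freeCount ρ → ∃ λ i → IsLit (lookup ρ i)
one-lit (const _ ∷ ρ) h with one-lit ρ h
... | i , l = suc i , l
one-lit (lit l ∷ ρ)   _ = zero , l , refl

two-lits : ∀ {n} (ρ : Vec Abs n) → 2 ≤ freeCount ρ →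
  ∃₂ λ i j → IsLit (lookup ρ i) × IsLit (lookup ρ j) × i ≢ j
two-lits (const _ ∷ ρ) h with two-lits ρ h
... | i , j , li , lj , i≢j = suc i , suc j , li , lj , i≢j ∘ Fin.suc-injective
two-lits (lit l ∷ ρ) (s≤s h) with one-lit ρ h
... | j , lj = zero , suc j , (l , refl) , lj , λ ()

lit⇒free : ∀ {n} (ρ : Vec Abs n) → Partial ρ → ∀ {i} → IsLit (lookup ρ i) → Free ρ i
lit⇒free ρ part {i} (l , eq) with part i
... | inj₁ free       = free
... | inj₂ (b , eq′) with () ← trans (sym eq) eq′

Correct : ∀ {n} → Circuit n → Vec Bool n → Set
Correct C x = bit (eval C x) ≡ XOR x

module _ {n} (C : Circuit n) {ρ : Vec Abs n} (part : Partial ρ) where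

  private
    N = nodes C ρ
    o = out C ρ

  restrict : ∀ ρ′ → Refines ρ ρ′ →
    Restriction n (at ρ′) N o (out C ρ′) (count C ρ′)
  restrict ρ′ ref = subst (λ r → Restriction n (at ρ′) N o (out C r) (count C r))
    (refine part ref)
    (restriction C ρ (at ρ′) λ i → On-map (FreeLevel<n ρ) (lookup ρ i) (freeLevels ρ part i))

  two-free : 2 ≤ freeCount ρ → ∃₂ λ i j → FreeLevel ρ i × FreeLevel ρ j × i ≢ j
  two-free h with two-lits ρ h
  ... | i , j , li , lj , i≢j = level i , level j , (i , refl , lit⇒free ρ part li) ,
    (j , refl , lit⇒free ρ part lj) , i≢j ∘ level-injective

  candidate : Fin n → Bool → Fin n → Bool → Vec Bool n
  candidate i b j c = fill (ρ [ i ]≔ const b [ j ]≔ const c)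

  module Candidate {i j} (free-i : Free ρ i) (free-j : Free ρ j) (i≢j : i ≢ j) where

    lookup-i : ∀ b c → lookup (candidate i b j c) i ≡ b
    lookup-i b c = trans (lookup-map i bitOf (ρ [ i ]≔ const b [ j ]≔ const c))
      (cong bitOf (trans (lookup∘update′ i≢j (ρ [ i ]≔ const b) _) (lookup∘update i ρ _)))

    lookup-j : ∀ b c → lookup (candidate i b j c) j ≡ c
    lookup-j b c = trans (lookup-map j bitOf (ρ [ i ]≔ const b [ j ]≔ const c))
      (cong bitOf (lookup∘update j (ρ [ i ]≔ const b) _))

    lookup-other : ∀ b b′ c {k} → k ≢ i →
      lookup (candidate i b j c) k ≡ lookup (candidate i b′ j c) k
    lookup-other b b′ c {k} k≢i with k Fin.≟ j
    ... | yes refl = trans (lookup-j b c) (sym (lookup-j b′ c))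
    ... | no  k≢j  = trans (other b) (sym (other b′))
      where
      other : ∀ b → lookup (candidate i b j c) k ≡ bitOf (lookup ρ k)
      other b = trans (lookup-map k bitOf (ρ [ i ]≔ const b [ j ]≔ const c))
        (cong bitOf (trans (lookup∘update′ k≢j (ρ [ i ]≔ const b) _) (lookup∘update′ k≢i ρ _)))

    refines : ∀ b c → Refines ρ (Vec.map const (candidate i b j c))
    refines b c k eq = refine-fill (ρ₁ [ j ]≔ const c) k
      (refine-update ρ₁ c free-j′ k (refine-update ρ b free-i k eq))
      where
      ρ₁ = ρ [ i ]≔ const b
      free-j′ : Free ρ₁ j
      free-j′ = trans (lookup∘update′ (i≢j ∘ sym) ρ _) free-j

    -- Flipping bit `i` of a candidate flips its parity, hence the output if both candidates are
    -- correct. Being refinements of `ρ`, the candidates yield solutions of the simplified circuit,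
    -- which inherit the difference.
    sensitive : (∀ b c → Correct C (candidate i b j c)) → ∀ c → ∃₂ λ θ θ′ →
      Solves θ N × Solves θ′ N ×
      (∀ {k} → FreeLevel ρ k → k ≢ level i → θ k ≡ θ′ k) ×
      θ (level j) ≡ const c × θ ⟨ o ⟩ ≢ θ′ ⟨ o ⟩
    sensitive correct c =
      solution , solution′ , solves , R′.solves , same ,
      trans (value-at false (level<n j) j refl) (cong const (lookup-j false c)) , differ
      where
      x : Bool → Vec Bool n
      x b = candidate i b j c
      R : ∀ b → Restriction n (at (Vec.map const (x b))) N o (out C (Vec.map const (x b)))
            (count C (Vec.map const (x b)))
      R b = restrict _ (refines b c)
      open Restriction (R false) using (solution; solves)
      module R′ = Restriction (R true)
      solution′ = R′.solution
      value-at : ∀ b {k} → k < n → ∀ z → k ≡ level z →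
        Restriction.solution (R b) k ≡ const (lookup (x b) z)
      value-at b k<n z refl = trans (Restriction.extends (R b) k<n)
        (trans (at-level (Vec.map const (x b)) z) (lookup-map z const (x b)))
      same : ∀ {k} → FreeLevel ρ k → k ≢ level i → solution k ≡ solution′ k
      same (z , refl , _) k≢i = trans (value-at false (level<n z) z refl)
        (trans (cong const (lookup-other false true c λ { refl → k≢i refl }))
          (sym (value-at true (level<n z) z refl)))
      out-value : ∀ b → Restriction.solution (R b) ⟨ o ⟩ ≡ const (parity (x b))
      out-value b = trans (sym (Restriction.out≡ (R b))) (trans (out-const C (x b))
        (cong const (bit-injective (trans (correct b c) (XOR-parity (x b))))))
      const-injective : ∀ {b c} → const b ≡ const c → b ≡ c
      const-injective refl = refl
      differ : solution ⟨ o ⟩ ≢ solution′ ⟨ o ⟩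
      differ eq = parity-flip (x false) (x true) i
        (λ e → false≢true (trans (sym (lookup-i false c)) (trans e (lookup-i true c))))
        (lookup-other false true c)
        (const-injective (trans (sym (out-value false)) (trans eq (out-value true))))
        where
        false≢true : false ≢ true
        false≢true ()

  refuted : 2 ≤ freeCount ρ →
    (∀ i c → ¬ (count C (ρ [ i ]≔ const c) + 3 ≤ count C ρ)) →
    (∀ i b j c → Correct C (candidate i b j c)) → ⊥
  refuted enough stuck correct = Elimination.impossible
    (wellFormed C ρ (freeLevels ρ part) (FreeLevel<n ρ)) (FreeLevel<n ρ) (two-free enough)
    (λ { (i , refl , fi) (j , refl , fj) i≢j →
      Candidate.sensitive fi fj (λ { refl → i≢j refl }) (λ b c → correct i b j c) })
    (λ { (i , refl , fi) c →
      let open Restriction (restrict (ρ [ i ]≔ const c) (refine-update ρ c fi)) in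
      solution , solves ,
      trans (extends (level<n i)) (trans (at-level (ρ [ i ]≔ const c) i) (lookup∘update i ρ _)) ,
      λ h → stuck i c (subst (λ s → s + 3 ≤ count C ρ) (sym count≡) h) })

-- Greedy assignments

Assigns : ∀ {n} → Vec Abs n → Vec Abs n → Set
Assigns ρ ρ′ = ∃₂ λ i c → ρ′ ≡ ρ [ i ]≔ const c

-- Inputs already assigned may be overwritten, which spares a test for free ones: such a step costs
-- no free input. The reversal matches the left fold in `prependTerm`.
assignments : ∀ {n} → Vec Abs n → List (Vec Abs n)
assignments []      = []
assignments (a ∷ ρ) =
  (const false ∷ ρ) ∷ (const true ∷ ρ) ∷ List.reverse (List.map (a ∷_) (assignments ρ))

∈-assignments⁺ : ∀ {n} (ρ : Vec Abs n) i c → ρ [ i ]≔ const c ∈ assignments ρ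
∈-assignments⁺ (a ∷ ρ) zero    false = here refl
∈-assignments⁺ (a ∷ ρ) zero    true  = there (here refl)
∈-assignments⁺ (a ∷ ρ) (suc i) c     =
  there (there (reverse⁺ (∈-map⁺ (a ∷_) (∈-assignments⁺ ρ i c))))

∈-assignments⁻ : ∀ {n} (ρ : Vec Abs n) {ρ′} → ρ′ ∈ assignments ρ → Assigns ρ ρ′
∈-assignments⁻ (a ∷ ρ) (here refl)         = zero , false , refl
∈-assignments⁻ (a ∷ ρ) (there (here refl)) = zero , true , refl
∈-assignments⁻ (a ∷ ρ) (there (there ρ′∈))
  with ρ″ , ρ″∈ , refl ← ∈-map⁻ (a ∷_) (reverse⁻ {xs = List.map (a ∷_) (assignments ρ)} ρ′∈)
  with i , c , refl ← ∈-assignments⁻ ρ ρ″∈ = suc i , c , refl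

-- count C ρ < 3 * (freeCount ρ − 1), without truncated subtraction.
Cheap : ∀ {n} → Circuit n → Vec Abs n → Set
Cheap C ρ = Partial ρ × count C ρ + 3 < 3 * freeCount ρ

Improves : ∀ {n} → Circuit n → Vec Abs n → Vec Abs n → Set
Improves C ρ ρ′ = count C ρ′ + 3 ≤ count C ρ

cheap-initial : ∀ n (C : Circuit n) → size C < 3 * (n ∸ 1) → Cheap C (initial n)
cheap-initial (suc n) C small = inj₁ ∘ lookup-initial ,
  subst (λ m → count C (initial (suc n)) + 3 < 3 * m) (sym (freeCount-initial (suc n)))
    (subst (count C (initial (suc n)) + 3 <_) (arith n)
      (+-monoˡ-< 3 (≤-<-trans (count≤size C (initial (suc n))) small)))
  where
  arith : ∀ n → 3 * n + 3 ≡ 3 * suc n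
  arith = solve-∀

-- The left side of the bound drops by at least 3; the right side drops by at most 3, since at most
-- one free input is lost.
cheap-improves : ∀ {n} {C : Circuit n} {ρ ρ′} → Assigns ρ ρ′ → Improves C ρ ρ′ →
  Cheap C ρ → Cheap C ρ′
cheap-improves {C = C} {ρ} (i , c , refl) improves (part , cheap) =
  part′ , +-cancelʳ-< 3 _ _ (begin-strict
  count C ρ′ + 3 + 3         ≤⟨ +-monoˡ-≤ 3 improves ⟩
  count C ρ + 3              <⟨ cheap ⟩
  3 * freeCount ρ            ≤⟨ *-monoʳ-≤ 3 (freeCount-update ρ i c) ⟩
  3 * suc (freeCount ρ′)     ≡⟨ arith (freeCount ρ′) ⟩
  3 * freeCount ρ′ + 3       ∎)
  where
  open ≤-Reasoning
  ρ′ = ρ [ i ]≔ const c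
  arith : ∀ n → 3 * suc n ≡ 3 * n + 3
  arith = solve-∀
  part′ : Partial ρ′
  part′ j with j Fin.≟ i
  ... | yes refl = inj₂ (c , lookup∘update i ρ _)
  ... | no  j≢i  rewrite lookup∘update′ j≢i ρ (const c) = part j

-- The extra 3 in `Cheap`, which stems from `n − 1` in place of `n` in the size bound, excludes that
-- a single free input is left.
cheap⇒2≤ : ∀ {n} {C : Circuit n} {ρ} → Cheap C ρ → 2 ≤ freeCount ρ
cheap⇒2≤ {C = C} {ρ} (_ , cheap) = *-cancelˡ-< 3 1 (freeCount ρ) (≤-<-trans (m≤n+m 3 (count C ρ)) cheap)

counterexample-exists : ∀ {n} (C : Circuit n) {ρ} → Cheap C ρ →
  (∀ {ρ′} → ρ′ ∈ assignments ρ → ¬ Improves C ρ ρ′) →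
  ¬ (∀ {ρ′ ρ″} → ρ′ ∈ assignments ρ → ρ″ ∈ assignments ρ′ → Correct C (fill ρ″))
counterexample-exists C {ρ} cheap stuck correct = refuted C (cheap .proj₁) (cheap⇒2≤ {C = C} cheap)
  (λ i c → stuck (∈-assignments⁺ ρ i c))
  (λ i b j c → correct (∈-assignments⁺ ρ i b) (∈-assignments⁺ _ j c))

-- The refuter and its correctness

-- Bits are encoded as in encodeBits, so that assignments of all inputs and
-- inputs have the same code.
encodeAbs : Abs → Tree
encodeAbs (const b)     = encodeBool b
encodeAbs (lit (p , i)) = cons (cons nil (encodeBool p)) (encodeℕ i)

encodeEnv : ∀ {w} → Vec Abs w → Tree
encodeEnv ρ = tree (Vec.map encodeAbs ρ)

encodeReduct : Reduct → Tree
encodeReduct (inj₁ a) = cons nil (encodeAbs a)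
encodeReduct (inj₂ _) = nil

encodeList : ∀ {A : Set} → (A → Tree) → List A → Tree
encodeList enc []       = nil
encodeList enc (x ∷ xs) = cons (enc x) (encodeList enc xs)

encodeBits-const : ∀ {n} (x : Vec Bool n) → encodeEnv (Vec.map const x) ≡ encodeBits x
encodeBits-const []      = refl
encodeBits-const (b ∷ x) = cong (cons _) (encodeBits-const x)

length-spine : ∀ t → length (spine t) ≡ ∣ t ∣
length-spine nil        = refl
length-spine (cons _ t) = cong suc (length-spine t)

∣ℕ∣ : ∀ n → ∣ encodeℕ n ∣ ≡ n
∣ℕ∣ zero    = refl
∣ℕ∣ (suc n) = cong suc (∣ℕ∣ n)

spine-ℕ : ∀ n → spine (encodeℕ n) ≡ replicate n nil
spine-ℕ zero    = refl
spine-ℕ (suc n) = cong (nil ∷_) (spine-ℕ n)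

∣tree∣ : ∀ {n} (ρ : Vec Tree n) → ∣ tree ρ ∣ ≡ n
∣tree∣ []      = refl
∣tree∣ (_ ∷ ρ) = cong suc (∣tree∣ ρ)

∣bits∣ : ∀ {n} (x : Vec Bool n) → ∣ encodeBits x ∣ ≡ n
∣bits∣ []      = refl
∣bits∣ (_ ∷ x) = cong suc (∣bits∣ x)

∣list∣ : ∀ {A : Set} (enc : A → Tree) xs → ∣ encodeList enc xs ∣ ≡ length xs
∣list∣ enc []       = refl
∣list∣ enc (x ∷ xs) = cong suc (∣list∣ enc xs)

spine-list : ∀ {A : Set} (enc : A → Tree) xs → spine (encodeList enc xs) ≡ List.map enc xs
spine-list enc []       = refl
spine-list enc (x ∷ xs) = cong (enc x ∷_) (spine-list enc xs)

-- The algorithm as terms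

-- In the body of a fold, v0 is the accumulator and v1 the current element.
pattern v0 = var zero
pattern v1 = var (suc zero)
pattern v2 = var (suc (suc zero))
pattern v3 = var (suc (suc (suc zero)))
pattern v4 = var (suc (suc (suc (suc zero))))
pattern v5 = var (suc (suc (suc (suc (suc zero)))))

pattern one = cons nil nil

opaque
  notTerm : Term 1
  notTerm = if v0 then nil else one

opaque
  eqTestTerm : Term 1
  eqTestTerm = if v0 then (if tl v0 then nil else one) else nil

opaque
  -- The accumulator is nil after a mismatch, otherwise it is paired with nil to
  -- tell it from a mismatch.
  eqTerm : Term 2
  eqTerm = call eqTestTerm
    (fold v0 (cons nil v1) (if tl v0 then cons nil (tl (tl v0)) else nil) ∷ [])

opaque
  flipTerm : Term 1
  flipTerm = if hd v0 then cons (cons nil (call notTerm (tl (hd v0) ∷ []))) (tl v0)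
    else call notTerm (v0 ∷ [])

opaque
  -- `hd` separates the codes: it is nil for both constants and not nil for a literal. The result
  -- nil means that the gate survives.
  meetTerm : Term 2
  meetTerm =
    if hd v0
    then (if hd v1
      then (if call eqTerm (tl v0 ∷ tl v1 ∷ [])
        then cons nil (if tl (hd v0) then (if tl (hd v1) then v0 else nil)
                                     else (if tl (hd v1) then nil else v0))
        else nil)
      else (if v1 then cons nil v0 else cons nil nil))
    else (if v0 then cons nil v1 else cons nil nil)

opaque
  lookupTerm : Term 2
  lookupTerm = hd (fold v1 v0 (tl v0))

opaque
  -- The nested tests read off the unary tag of the gate: 0 constant, 1 negation, 2 conjunction, 3
  -- disjunction.
  reductTerm : Term 2
  reductTerm =
    if hd v0
    then (if tl (hd v0)
      then (if tl (tl (hd v0))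
        then call meetTerm (call flipTerm (input₁ ∷ []) ∷ call flipTerm (input₂ ∷ []) ∷ [])
        else call meetTerm (input₁ ∷ input₂ ∷ []))
      else cons nil (call lookupTerm (v1 ∷ tl v0 ∷ [])))
    else cons nil (tl v0)
    where
    input₁ input₂ : Term 2
    input₁ = call lookupTerm (v1 ∷ hd (tl v0) ∷ [])
    input₂ = call lookupTerm (v1 ∷ tl (tl v0) ∷ [])

opaque
  signTerm : Term 2
  signTerm =
    if hd v0
    then (if tl (hd v0)
      then (if tl (tl (hd v0)) then call flipTerm (v1 ∷ []) else v1)
      else call flipTerm (v1 ∷ []))
    else v1

opaque
  -- A state consists of the number of wires, the number of surviving gates and
  -- the environment; the arguments are a reduct, its gate and a state.
  advanceTerm : Term 3
  advanceTerm =
    cons (cons nil (hd v2))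
      (cons (if v0 then hd (tl v2) else cons nil (hd (tl v2)))
        (cons (call signTerm (v1 ∷ (if v0 then tl v0 else cons (cons nil one) (hd v2)) ∷ []))
          (tl (tl v2))))

opaque
  -- The code cons nil i of an output has a spine of i + 1 times nil, hence
  -- the output is found by popping a wire for each nil.
  stepTerm : Term 2
  stepTerm =
    if v1
    then call advanceTerm (call reductTerm (v1 ∷ tl (tl v0) ∷ []) ∷ v1 ∷ v0 ∷ [])
    else cons (hd (tl (tl v0))) (cons (hd (tl v0)) (tl (tl (tl v0))))

opaque
  -- The arguments are the number of inputs, a circuit and an environment.
  runTerm : Term 3
  runTerm = fold v1 (cons v0 (cons nil v2)) (call stepTerm (v0 ∷ v1 ∷ []))

opaque
  countTerm : Term 3
  countTerm = hd (tl (call runTerm (v0 ∷ v1 ∷ v2 ∷ [])))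

opaque
  parityTerm : Term 1
  parityTerm = fold v0 nil (if v1 then call notTerm (v0 ∷ []) else v0)

opaque
  wrongTerm : Term 3
  wrongTerm = if hd (call runTerm (v0 ∷ v1 ∷ v2 ∷ []))
    then call notTerm (call parityTerm (v2 ∷ []) ∷ []) else call parityTerm (v2 ∷ [])

opaque
  reverseTerm : Term 1
  reverseTerm = fold v0 nil (cons v1 v0)

opaque
  fillTerm : Term 1
  fillTerm = fold (call reverseTerm (v0 ∷ [])) nil (cons (if hd v1 then nil else v1) v0)

opaque
  prependTerm : Term 2
  prependTerm = fold v1 nil (cons (cons v2 v1) v0)

opaque
  -- The accumulator pairs the environment rebuilt so far with its assignments. It grows from the
  -- end, as in the recursion of `assignments`, hence the reversed list.
  assignmentsTerm : Term 1
  assignmentsTerm = tl (fold (call reverseTerm (v0 ∷ [])) (cons nil nil)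
    (cons (cons v1 (hd v0))
      (cons (cons nil (hd v0)) (cons (cons one (hd v0)) (call prependTerm (v1 ∷ tl v0 ∷ []))))))

opaque
  orElseTerm : Term 2
  orElseTerm = if v0 then v0 else v1

-- The last hit wins. A hit is any value other than nil, which is why results are wrapped as
-- `cons nil _`: the code of an empty environment or input is nil.
search : ∀ {Γ} → Term Γ → Term (suc (suc Γ)) → Term Γ
search l f = fold l nil (call orElseTerm (f ∷ v0 ∷ []))

opaque
  -- The fold subtracts the first number from the second. Two more tails leave something exactly if
  -- the difference is at least three, the gain demanded by `Improves`.
  gapTerm : Term 2
  gapTerm = tl (tl (fold v0 v1 (tl v0)))

opaque
  improvementTerm : Term 4
  improvementTerm =
    if call gapTerm (call countTerm (v0 ∷ v1 ∷ v3 ∷ []) ∷ call countTerm (v0 ∷ v1 ∷ v2 ∷ []) ∷ [])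
    then cons nil v3 else nil

opaque
  tailOrTerm : Term 2
  tailOrTerm = if v0 then tl v0 else v1

opaque
  improveTerm : Term 3
  improveTerm = call tailOrTerm
    (search (call assignmentsTerm (v2 ∷ [])) (call improvementTerm (v2 ∷ v3 ∷ v4 ∷ v1 ∷ [])) ∷ v2 ∷ [])

opaque
  initialTerm : Term 1
  initialTerm = tl (fold v0 (cons nil nil)
    (cons (cons nil (hd v0)) (cons (cons (cons nil one) (hd v0)) (tl v0))))

opaque
  -- The code of the circuit serves as a clock: it has more entries than there are gates, and every
  -- successful round removes gates.
  greedyTerm : Term 2
  greedyTerm = fold v1 (call initialTerm (v0 ∷ [])) (call improveTerm (v2 ∷ v3 ∷ v0 ∷ []))

opaque
  ifWrongTerm : Term 3
  ifWrongTerm = if call wrongTerm (v0 ∷ v1 ∷ v2 ∷ []) then cons nil v2 else nil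

opaque
  counterexampleTerm : Term 3
  counterexampleTerm = search (call assignmentsTerm (v2 ∷ []))
    (search (call assignmentsTerm (v1 ∷ []))
      (call ifWrongTerm (v4 ∷ v5 ∷ call fillTerm (v1 ∷ []) ∷ [])))

opaque
  refuteTerm : Term 1
  refuteTerm = tl (call counterexampleTerm
    (hd v0 ∷ tl v0 ∷ call greedyTerm (hd v0 ∷ tl v0 ∷ []) ∷ []))

gates : ∀ {w} → Circuit w → ℕ
gates (output _) = 0
gates (_ ▷ C)    = suc (gates C)

count≤gates : ∀ {w} (C : Circuit w) ρ → count C ρ ≤ gates C
count≤gates (output i) ρ = z≤n
count≤gates (g ▷ C)    ρ =
  ≤-trans (count-addNode _ (reduct g ρ) _) (s≤s (count≤gates C (gateAbs g ρ ∷ ρ)))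

gates<code : ∀ {w} (C : Circuit w) → gates C < ∣ encodeCircuit C ∣
gates<code (output i) = s≤s z≤n
gates<code (g ▷ C)    = s≤s (gates<code C)

gateAbs-On : ∀ {P : ℕ → Set} {w} (g : Gate w) ρ → P w → EnvOn P ρ → On P (gateAbs g ρ)
gateAbs-On {w = w} g ρ Pw hs with reduct g ρ in eq
... | inj₁ a = On-signed (polarity g) a (reduct-On g ρ eq hs)
... | inj₂ _ = On-signed (polarity g) (lit (true , w)) Pw

Assigns-On : ∀ {P : ℕ → Set} {n} (ρ : Vec Abs n) → EnvOn P ρ → ∀ {ρ′} → Assigns ρ ρ′ → EnvOn P ρ′
Assigns-On ρ hs (i , c , refl) j with j Fin.≟ i
... | yes refl rewrite lookup∘update i ρ (const c)      = tt
... | no  j≢i  rewrite lookup∘update′ j≢i ρ (const c) = hs j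

length-assignments : ∀ {n} (ρ : Vec Abs n) → length (assignments ρ) ≡ n + n
length-assignments []      = refl
length-assignments {suc n} (a ∷ ρ) = trans
  (cong (2 +_) (trans (length-reverse (List.map (a ∷_) (assignments ρ)))
    (trans (length-map (a ∷_) (assignments ρ)) (length-assignments ρ))))
  (cong suc (sym (+-suc n n)))

state : ∀ {w} → ℕ → Vec Abs w → Tree
state {w} c ρ = cons (encodeℕ w) (cons (encodeℕ c) (encodeEnv ρ))

-- Values of the terms for sufficiently large `K`

module _ {K : ℕ} where

  take-spine : ∀ {t} → ∣ t ∣ ≤ K → take K (spine t) ≡ spine t
  take-spine {t} h = take-all K (spine t) (subst (_≤ K) (sym (length-spine t)) h)

  take-ℕ : ∀ {n} → n ≤ K → take K (spine (encodeℕ n)) ≡ replicate n nil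
  take-ℕ {n} h = trans (take-spine (subst (_≤ K) (sym (∣ℕ∣ n)) h)) (spine-ℕ n)

  opaque
    unfolding notTerm

    not-correct : ∀ b → value K notTerm (encodeBool b ∷ []) ≡ encodeBool (not b)
    not-correct false = refl
    not-correct true  = refl

  opaque
    unfolding eqTestTerm eqTerm

    private
      eqStep : Tree → Tree → Tree
      eqStep t _ = ifT (tail t) (cons nil (tail (tail t))) nil

      matches : ℕ → ℕ → Tree
      matches m n = foldl eqStep (cons nil (encodeℕ n)) (replicate m nil)

    eq-refl : ∀ {n} → n ≤ K → value K eqTerm (encodeℕ n ∷ encodeℕ n ∷ []) ≡ one
    eq-refl {n} h rewrite take-ℕ h = go n
      where
      go : ∀ n → value K eqTestTerm (matches n n ∷ []) ≡ one
      go zero    = refl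
      go (suc n) = go n

    eq-≢ : ∀ {m n} → m ≤ K → m ≢ n → value K eqTerm (encodeℕ m ∷ encodeℕ n ∷ []) ≡ nil
    eq-≢ {m} {n} h m≢n rewrite take-ℕ h = go m n m≢n
      where
      mismatch : ∀ m → foldl eqStep nil (replicate m nil) ≡ nil
      mismatch zero    = refl
      mismatch (suc m) = mismatch m
      go : ∀ m n → m ≢ n → value K eqTestTerm (matches m n ∷ []) ≡ nil
      go zero    zero    m≢n = contradiction refl m≢n
      go zero    (suc n) m≢n = refl
      go (suc m) zero    m≢n = cong (λ t → value K eqTestTerm (t ∷ [])) (mismatch m)
      go (suc m) (suc n) m≢n = go m n (m≢n ∘ cong suc)

  opaque
    unfolding flipTerm

    flip-correct : ∀ a → value K flipTerm (encodeAbs a ∷ []) ≡ encodeAbs (flipped a)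
    flip-correct (const false)     = not-correct false
    flip-correct (const true)      = not-correct true
    flip-correct (lit (p , i)) = cong (λ b → cons (cons nil b) (encodeℕ i)) (not-correct p)

  opaque
    unfolding meetTerm

    meet-correct : ∀ a b → On (_≤ K) a →
      value K meetTerm (encodeAbs a ∷ encodeAbs b ∷ []) ≡ encodeReduct (meet a b)
    meet-correct (const false) b h = refl
    meet-correct (const true)  b h = refl
    meet-correct (lit _) (const false) h = refl
    meet-correct (lit _) (const true)  h = refl
    meet-correct (lit (p , i)) (lit (q , j)) h with i ≟ j
    ... | no i≢j rewrite eq-≢ h i≢j = refl
    meet-correct (lit (false , i)) (lit (false , i)) h | yes refl rewrite eq-refl h = refl
    meet-correct (lit (false , i)) (lit (true  , i)) h | yes refl rewrite eq-refl h = refl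
    meet-correct (lit (true  , i)) (lit (false , i)) h | yes refl rewrite eq-refl h = refl
    meet-correct (lit (true  , i)) (lit (true  , i)) h | yes refl rewrite eq-refl h = refl

  opaque
    unfolding lookupTerm

    lookup-correct : ∀ {w} (ρ : Vec Abs w) i → w ≤ K →
      value K lookupTerm (encodeEnv ρ ∷ encodeFin i ∷ []) ≡ encodeAbs (lookup ρ i)
    lookup-correct ρ i h rewrite take-ℕ (≤-trans (<⇒≤ (toℕ<n i)) h) = go ρ i
      where
      go : ∀ {w} (ρ : Vec Abs w) i →
        head (foldl (λ t (_ : Tree) → tail t) (encodeEnv ρ) (replicate (toℕ i) nil)) ≡
        encodeAbs (lookup ρ i)
      go (a ∷ ρ) zero    = refl
      go (a ∷ ρ) (suc i) = go ρ i

  opaque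
    unfolding reductTerm

    reduct-correct : ∀ {w} (g : Gate w) ρ → w ≤ K → EnvOn (_≤ K) ρ →
      value K reductTerm (encodeGate g ∷ encodeEnv ρ ∷ []) ≡ encodeReduct (reduct g ρ)
    reduct-correct (const b) ρ h hs = refl
    reduct-correct (neg i)   ρ h hs rewrite lookup-correct ρ i h = refl
    reduct-correct (and i j) ρ h hs rewrite lookup-correct ρ i h | lookup-correct ρ j h =
      meet-correct (lookup ρ i) (lookup ρ j) (hs i)
    reduct-correct (or i j)  ρ h hs
      rewrite lookup-correct ρ i h | lookup-correct ρ j h
            | flip-correct (lookup ρ i) | flip-correct (lookup ρ j) =
      meet-correct (flipped (lookup ρ i)) (flipped (lookup ρ j)) (On-flipped (lookup ρ i) (hs i))

  opaque
    unfolding signTerm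

    sign-correct : ∀ {w} (g : Gate w) a →
      value K signTerm (encodeGate g ∷ encodeAbs a ∷ []) ≡ encodeAbs (signed (polarity g) a)
    sign-correct (const b) a = refl
    sign-correct (neg i)   a = flip-correct a
    sign-correct (and i j) a = refl
    sign-correct (or i j)  a = flip-correct a

  opaque
    unfolding advanceTerm

    advance-correct : ∀ {w} (g : Gate w) r c (ρ : Vec Abs w) →
      value K advanceTerm (encodeReduct r ∷ encodeGate g ∷ state c ρ ∷ []) ≡
      state (weight r + c) (signed (polarity g) (result w r) ∷ ρ)
    advance-correct {w} g (inj₁ a) c ρ rewrite sign-correct g a = refl
    advance-correct {w} g (inj₂ n) c ρ rewrite sign-correct g (lit (true , w)) = refl

  opaque
    unfolding stepTerm

    step-correct : ∀ {w} (g : Gate w) c ρ → w ≤ K → EnvOn (_≤ K) ρ →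
      value K stepTerm (state c ρ ∷ encodeGate g ∷ []) ≡
      state (weight (reduct g ρ) + c) (gateAbs g ρ ∷ ρ)
    step-correct {w} g c ρ h hs = trans (gate g)
      (trans (cong (λ r → value K advanceTerm (r ∷ encodeGate g ∷ state c ρ ∷ []))
        (reduct-correct g ρ h hs)) (advance-correct g (reduct g ρ) c ρ))
      where
      gate : ∀ (g : Gate w) → value K stepTerm (state c ρ ∷ encodeGate g ∷ []) ≡
        value K advanceTerm (value K reductTerm (encodeGate g ∷ encodeEnv ρ ∷ []) ∷
          encodeGate g ∷ state c ρ ∷ [])
      gate (const _) = refl
      gate (neg _)   = refl
      gate (and _ _) = refl
      gate (or _ _)  = refl

    step-nil : ∀ a c t → value K stepTerm (cons a (cons c t) ∷ nil ∷ []) ≡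
      cons (head t) (cons c (tail t))
    step-nil a c t = refl

  step : Tree → Tree → Tree
  step s e = value K stepTerm (s ∷ e ∷ [])

  pop-correct : ∀ {w} a c (ρ : Vec Abs w) i → ∃ λ t →
    foldl step (cons a (cons c (encodeEnv ρ))) (nil ∷ spine (encodeFin i)) ≡
    cons (encodeAbs (lookup ρ i)) (cons c t)
  pop-correct a c (b ∷ ρ) zero    = _ , step-nil a c _
  pop-correct a c (b ∷ ρ) (suc i) rewrite step-nil a c (encodeEnv (b ∷ ρ)) =
    pop-correct (encodeAbs b) c ρ i

  -- `w + gates C` does not change when a gate is consumed, so the one bound by `K` covers all wire
  -- numbers that are ever looked up or compared.
  steps-correct : ∀ {w} (C : Circuit w) c ρ → w + gates C ≤ K → EnvOn (_≤ K) ρ → ∃ λ t →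
    foldl step (state c ρ) (spine (encodeCircuit C)) ≡
    cons (encodeAbs (out C ρ)) (cons (encodeℕ (count C ρ + c)) t)
  steps-correct (output i) c ρ h hs = pop-correct _ _ ρ i
  steps-correct {w} (g ▷ C) c ρ h hs
    rewrite step-correct g c ρ (≤-trans (m≤m+n w _) h) hs
    with steps-correct C (weight (reduct g ρ) + c) (gateAbs g ρ ∷ ρ)
      (subst (_≤ K) (+-suc w (gates C)) h)
      (EnvOn-∷ (gateAbs-On g ρ (≤-trans (m≤m+n w _) h) hs) hs)
  ... | t , eq = t , trans eq
    (cong (λ m → cons (encodeAbs (out C (gateAbs g ρ ∷ ρ))) (cons (encodeℕ m) t)) (arith (reduct g ρ)))
    where
    ns = nodes C (gateAbs g ρ ∷ ρ)
    arith : ∀ r → length ns + (weight r + c) ≡ length (addNode w r ns) + c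
    arith (inj₁ _) = refl
    arith (inj₂ _) = +-suc (length ns) c

  opaque
    unfolding parityTerm

    parity-correct : ∀ {n} (x : Vec Bool n) → n ≤ K →
      value K parityTerm (encodeBits x ∷ []) ≡ encodeBool (parity x)
    parity-correct x h rewrite take-spine (subst (_≤ K) (sym (∣bits∣ x)) h) = go false x
      where
      flipIf : Tree → Tree → Tree
      flipIf acc e = ifT e (value K notTerm (acc ∷ [])) acc
      go : ∀ b {n} (x : Vec Bool n) →
        foldl flipIf (encodeBool b) (spine (encodeBits x)) ≡ encodeBool (b xor parity x)
      go b []          = cong encodeBool (sym (xor-identityʳ b))
      go b (false ∷ x) = go b x
      go b (true ∷ x) rewrite not-correct b = trans (go (not b) x)
        (cong encodeBool (trans (sym (not-distribˡ-xor b (parity x))) (not-distribʳ-xor b (parity x))))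

  opaque
    unfolding reverseTerm

    spine-reverse : ∀ t → ∣ t ∣ ≤ K →
      spine (value K reverseTerm (t ∷ [])) ≡ List.reverse (spine t)
    spine-reverse t h rewrite take-spine {t} h = go nil (spine t)
      where
      go : ∀ acc ts → spine (foldl (λ acc e → cons e acc) acc ts) ≡
        foldl (λ acc e → e ∷ acc) (spine acc) ts
      go acc []       = refl
      go acc (t ∷ ts) = go (cons t acc) ts

  fold-reverse : ∀ (f : Tree → Tree → Tree) z t → ∣ t ∣ ≤ K →
    foldl f z (take K (spine (value K reverseTerm (t ∷ [])))) ≡ foldr (λ e acc → f acc e) z (spine t)
  fold-reverse f z t h = begin
    foldl f z (take K (spine (value K reverseTerm (t ∷ []))))
      ≡⟨ cong (λ ts → foldl f z (take K ts)) (spine-reverse t h) ⟩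
    foldl f z (take K (List.reverse (spine t)))
      ≡⟨ cong (foldl f z) (take-all K _ (subst (_≤ K)
           (sym (trans (length-reverse (spine t)) (length-spine t))) h)) ⟩
    foldl f z (List.reverse (spine t))
      ≡⟨ reverse-foldl f z (spine t) ⟩
    foldr (λ e acc → f acc e) z (spine t) ∎
    where open ≡-Reasoning

  opaque
    unfolding fillTerm

    fill-correct : ∀ {n} (ρ : Vec Abs n) → n ≤ K →
      value K fillTerm (encodeEnv ρ ∷ []) ≡ encodeBits (fill ρ)
    fill-correct ρ h =
      trans (fold-reverse _ _ (encodeEnv ρ) (subst (_≤ K) (sym (∣tree∣ (Vec.map encodeAbs ρ))) h)) (go ρ)
      where
      go : ∀ {n} (ρ : Vec Abs n) →
        foldr (λ e acc → cons (ifT (head e) nil e) acc) nil (spine (encodeEnv ρ)) ≡ encodeBits (fill ρ)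
      go []                = refl
      go (const false ∷ ρ) = cong (cons nil) (go ρ)
      go (const true ∷ ρ)  = cong (cons one) (go ρ)
      go (lit _ ∷ ρ)       = cong (cons nil) (go ρ)

  opaque
    unfolding prependTerm

    prepend-correct : ∀ {n} a (ρs : List (Vec Abs n)) → length ρs ≤ K →
      value K prependTerm (encodeAbs a ∷ encodeList encodeEnv ρs ∷ []) ≡
      encodeList encodeEnv (List.reverse (List.map (a ∷_) ρs))
    prepend-correct {n} a ρs h
      rewrite take-spine (subst (_≤ K) (sym (∣list∣ encodeEnv ρs)) h) = go [] ρs
      where
      go : ∀ (acc : List (Vec Abs (suc n))) (ρs : List (Vec Abs n)) →
        foldl (λ acc e → cons (cons (encodeAbs a) e) acc) (encodeList encodeEnv acc)
          (spine (encodeList encodeEnv ρs)) ≡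
        encodeList encodeEnv (foldl (λ acc ρ → ρ ∷ acc) acc (List.map (a ∷_) ρs))
      go acc []       = refl
      go acc (ρ ∷ ρs) = go ((a ∷ ρ) ∷ acc) ρs

  opaque
    unfolding assignmentsTerm

    assignments-correct : ∀ {n} (ρ : Vec Abs n) → n + n ≤ K →
      value K assignmentsTerm (encodeEnv ρ ∷ []) ≡ encodeList encodeEnv (assignments ρ)
    assignments-correct {n} ρ h = cong tail
      (trans (fold-reverse _ _ (encodeEnv ρ)
          (subst (_≤ K) (sym (∣tree∣ (Vec.map encodeAbs ρ))) (≤-trans (m≤m+n n n) h)))
        (go ρ h))
      where
      extend : Tree → Tree → Tree
      extend e acc = cons (cons e (head acc)) (cons (cons nil (head acc)) (cons (cons one (head acc))
        (value K prependTerm (e ∷ tail acc ∷ []))))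
      go : ∀ {n} (ρ : Vec Abs n) → n + n ≤ K →
        foldr extend (cons nil nil) (spine (encodeEnv ρ)) ≡
        cons (encodeEnv ρ) (encodeList encodeEnv (assignments ρ))
      go []      h = refl
      go {suc n} (a ∷ ρ) h
        rewrite go ρ (≤-trans (+-mono-≤ (n≤1+n n) (n≤1+n n)) h)
              | prepend-correct a (assignments ρ) (subst (_≤ K) (sym (length-assignments ρ))
                  (≤-trans (+-mono-≤ (n≤1+n n) (n≤1+n n)) h)) = refl

  opaque
    unfolding orElseTerm

    orElse : ∀ s t → value K orElseTerm (s ∷ t ∷ []) ≡ ifT s s t
    orElse s t = refl

  opaque
    unfolding tailOrTerm

    tailOr : ∀ s t → value K tailOrTerm (s ∷ t ∷ []) ≡ ifT s (tail s) t
    tailOr s t = refl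

  opaque
    unfolding gapTerm

    gap-correct : ∀ m n → m ≤ K →
      value K gapTerm (encodeℕ m ∷ encodeℕ n ∷ []) ≡ encodeℕ (n ∸ m ∸ 2)
    gap-correct m n h rewrite take-ℕ h = trans (cong (tail ∘ tail) (go m n)) (drop2 (n ∸ m))
      where
      drop2 : ∀ n → tail (tail (encodeℕ n)) ≡ encodeℕ (n ∸ 2)
      drop2 zero          = refl
      drop2 (suc zero)    = refl
      drop2 (suc (suc n)) = refl
      nils : ∀ m → foldl (λ t (_ : Tree) → tail t) nil (replicate m nil) ≡ nil
      nils zero    = refl
      nils (suc m) = nils m
      go : ∀ m n → foldl (λ t (_ : Tree) → tail t) (encodeℕ n) (replicate m nil) ≡ encodeℕ (n ∸ m)
      go zero    n       = refl
      go (suc m) zero    = nils m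
      go (suc m) (suc n) = go m n

  opaque
    unfolding initialTerm

    initial-correct : ∀ n → n ≤ K → value K initialTerm (encodeℕ n ∷ []) ≡ encodeEnv (initial n)
    initial-correct n h rewrite take-ℕ h = cong tail (trans (go 0 n) (cong counted (+-identityʳ n)))
      where
      counted : ℕ → Tree
      counted k = cons (encodeℕ k) (encodeEnv (initial k))
      extend : Tree → Tree → Tree
      extend acc _ = cons (cons nil (head acc)) (cons (cons (cons nil one) (head acc)) (tail acc))
      go : ∀ k n → foldl extend (counted k) (replicate n nil) ≡ counted (n + k)
      go k zero    = refl
      go k (suc n) = trans (go (suc k) n) (cong counted (+-suc n k))

  opaque
    unfolding runTerm

    run-correct : ∀ {n} (C : Circuit n) ρ → n + gates C ≤ K → ∣ encodeCircuit C ∣ ≤ K →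
      EnvOn (_≤ K) ρ → ∃ λ t →
      value K runTerm (encodeℕ n ∷ encodeCircuit C ∷ encodeEnv ρ ∷ []) ≡
      cons (encodeAbs (out C ρ)) (cons (encodeℕ (count C ρ)) t)
    run-correct C ρ h h′ hs rewrite take-spine {encodeCircuit C} h′ with steps-correct C 0 ρ h hs
    ... | t , eq = t , trans eq
      (cong (λ m → cons (encodeAbs (out C ρ)) (cons (encodeℕ m) t)) (+-identityʳ _))

  FoundIn : ∀ {A : Set} → (A → Tree) → (Tree → Tree) → List A → Tree → Tree → Set
  FoundIn enc f xs z r =
    (r ≡ z × (∀ {x} → x ∈ xs → f (enc x) ≡ nil)) ⊎
    (∃ λ x → x ∈ xs × r ≡ f (enc x) × f (enc x) ≢ nil)

  found : ∀ {A : Set} (enc : A → Tree) (f : Tree → Tree) xs z →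
    FoundIn enc f xs z
      (foldl (λ acc e → value K orElseTerm (f e ∷ acc ∷ [])) z (List.map enc xs))
  found enc f []       z = inj₁ (refl , λ ())
  found enc f (x ∷ xs) z rewrite orElse (f (enc x)) z with f (enc x) in eq
  ... | nil with found enc f xs z
  ...   | inj₁ (r≡ , none)          = inj₁ (r≡ , λ { (here refl) → eq ; (there y∈) → none y∈ })
  ...   | inj₂ (y , y∈ , r≡ , some) = inj₂ (y , there y∈ , r≡ , some)
  found enc f (x ∷ xs) z | cons a b with found enc f xs (cons a b)
  ...   | inj₁ (r≡ , none)          =
    inj₂ (x , here refl , trans r≡ (sym eq) , λ e → cons≢nil (trans (sym eq) e))
    where
    cons≢nil : cons a b ≢ nil
    cons≢nil ()
  ...   | inj₂ (y , y∈ , r≡ , some) = inj₂ (y , there y∈ , r≡ , some)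

  search-correct : ∀ {A : Set} (enc : A → Tree) {Γ} (l : Term Γ) (t : Term (suc (suc Γ))) xs ρ
    (f : Tree → Tree) → (∀ acc e → value K t (acc ∷ e ∷ ρ) ≡ f e) →
    value K l ρ ≡ encodeList enc xs → length xs ≤ K →
    FoundIn enc f xs nil (value K (search l t) ρ)
  search-correct enc l t xs ρ f t≗f l≡ h
    rewrite l≡ | take-spine (subst (_≤ K) (sym (∣list∣ enc xs)) h) | spine-list enc xs =
    subst (FoundIn enc f xs nil)
      (foldl-cong (λ acc e → cong (λ r → value K orElseTerm (r ∷ acc ∷ [])) (sym (t≗f acc e)))
        nil (List.map enc xs))
      (found enc f xs nil)

  module _ {n} (C : Circuit n)
    (inputs≤ : n + n ≤ K) (wires≤ : n + gates C ≤ K) (code≤ : ∣ encodeCircuit C ∣ ≤ K)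
    where

    private
      n≤K : n ≤ K
      n≤K = ≤-trans (m≤m+n n n) inputs≤

      Small : Vec Abs n → Set
      Small = EnvOn (_≤ K)

      n# C# : Tree
      n# = encodeℕ n
      C# = encodeCircuit C

    opaque
      unfolding countTerm

      count-correct : ∀ ρ → Small ρ →
        value K countTerm (n# ∷ C# ∷ encodeEnv ρ ∷ []) ≡ encodeℕ (count C ρ)
      count-correct ρ hs = cong (head ∘ tail) (run-correct C ρ wires≤ code≤ hs .proj₂)

    const-small : ∀ x → Small (Vec.map const x)
    const-small x i rewrite lookup-map i Abs.const x = tt

    opaque
      unfolding wrongTerm

      wrong-correct : ∀ x →
        value K wrongTerm (n# ∷ C# ∷ encodeBits x ∷ []) ≡ encodeBool (eval C x xor parity x)
      wrong-correct x
        rewrite cong head (trans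
                  (cong (λ t → value K runTerm (n# ∷ C# ∷ t ∷ [])) (sym (encodeBits-const x)))
                  (run-correct C (Vec.map const x) wires≤ code≤ (const-small x) .proj₂))
              | out-const C x | parity-correct x n≤K | not-correct (parity x) with eval C x
      ... | false = refl
      ... | true  = refl

    opaque
      unfolding improvementTerm

      improvement-correct : ∀ ρ ρ′ → Small ρ → Small ρ′ →
        value K improvementTerm (n# ∷ C# ∷ encodeEnv ρ ∷ encodeEnv ρ′ ∷ []) ≡
        ifT (encodeℕ (count C ρ ∸ count C ρ′ ∸ 2)) (cons nil (encodeEnv ρ′)) nil
      improvement-correct ρ ρ′ hs hs′
        rewrite count-correct ρ hs | count-correct ρ′ hs′
              | gap-correct (count C ρ′) (count C ρ)
                  (≤-trans (count≤gates C ρ′) (≤-trans (m≤n+m (gates C) n) wires≤)) = refl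

    improvement-cases : ∀ ρ ρ′ →
      let r = ifT (encodeℕ (count C ρ ∸ count C ρ′ ∸ 2)) (cons nil (encodeEnv ρ′)) nil in
      (¬ Improves C ρ ρ′ × r ≡ nil) ⊎ (Improves C ρ ρ′ × r ≡ cons nil (encodeEnv ρ′))
    improvement-cases ρ ρ′ with count C ρ′ + 3 ≤? count C ρ
    ... | yes h = inj₂ (h , cong (λ m → ifT (encodeℕ m) (cons nil (encodeEnv ρ′)) nil) (positive _ _ h))
      where
      positive : ∀ m n → m + 3 ≤ n → n ∸ m ∸ 2 ≡ suc (n ∸ m ∸ 3)
      positive zero    (suc (suc (suc n))) h       = refl
      positive (suc m) (suc n)             (s≤s h) = positive m n h
      positive zero    (suc zero)          (s≤s ())
      positive zero    (suc (suc zero))    (s≤s (s≤s ()))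
    ... | no ¬h = inj₁ (¬h , cong (λ m → ifT (encodeℕ m) (cons nil (encodeEnv ρ′)) nil) (trivial _ _ ¬h))
      where
      trivial : ∀ m n → ¬ (m + 3 ≤ n) → n ∸ m ∸ 2 ≡ 0
      trivial m n ¬h = trans (∸-+-assoc n m 2) (m≤n⇒m∸n≡0 (s≤s⁻¹ (subst (n <_) (+-suc m 2) (≰⇒> ¬h))))

    Stuck : Vec Abs n → Set
    Stuck ρ = ∀ {ρ′} → ρ′ ∈ assignments ρ → ¬ Improves C ρ ρ′

    assignments≤ : (ρ : Vec Abs n) → length (assignments ρ) ≤ K
    assignments≤ ρ = subst (_≤ K) (sym (length-assignments ρ)) inputs≤

    opaque
      unfolding improveTerm

      improve-correct : ∀ ρ → Small ρ → let r = value K improveTerm (n# ∷ C# ∷ encodeEnv ρ ∷ []) in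
        (Stuck ρ × r ≡ encodeEnv ρ) ⊎
        (∃ λ ρ′ → ρ′ ∈ assignments ρ × Improves C ρ ρ′ × r ≡ encodeEnv ρ′)
      improve-correct ρ hs
        with search-correct encodeEnv (call assignmentsTerm (v2 ∷ []))
          (call improvementTerm (v2 ∷ v3 ∷ v4 ∷ v1 ∷ [])) (assignments ρ)
          (n# ∷ C# ∷ encodeEnv ρ ∷ []) (λ e → value K improvementTerm (n# ∷ C# ∷ encodeEnv ρ ∷ e ∷ []))
          (λ _ _ → refl) (assignments-correct ρ inputs≤) (assignments≤ ρ)
      ... | inj₁ (r≡ , none) = inj₁ (stuck ,
        trans (tailOr _ _) (cong (λ r → ifT r (tail r) (encodeEnv ρ)) r≡))
        where
        stuck : Stuck ρ
        stuck {ρ′} ρ′∈ improves with improvement-cases ρ ρ′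
        ... | inj₁ (¬improves , _) = ¬improves improves
        ... | inj₂ (_ , eq) with () ← trans (sym (none ρ′∈))
          (trans (improvement-correct ρ ρ′ hs (Assigns-On ρ hs (∈-assignments⁻ ρ ρ′∈))) eq)
      ... | inj₂ (ρ′ , ρ′∈ , r≡ , some)
        with improvement-cases ρ ρ′
           | improvement-correct ρ ρ′ hs (Assigns-On ρ hs (∈-assignments⁻ ρ ρ′∈))
      ...   | inj₁ (_ , eq)        | eq′ = contradiction (trans eq′ eq) some
      ...   | inj₂ (improves , eq) | eq′ = inj₂ (ρ′ , ρ′∈ , improves ,
        trans (tailOr _ _) (cong (λ r → ifT r (tail r) (encodeEnv ρ)) (trans r≡ (trans eq′ eq))))

    small : ∀ ρ → Partial ρ → Small ρ
    small ρ part i =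
      On-map (λ k∈ → ≤-trans (<⇒≤ (FreeLevel<n ρ k∈)) n≤K) (lookup ρ i) (freeLevels ρ part i)

    -- The alternative is the loop invariant: either the remaining rounds change nothing, or enough
    -- of them are left. With no round left the second case is absurd, so the result is stuck.
    improvements : ∀ (es : List Tree) ρ → Cheap C ρ → Stuck ρ ⊎ count C ρ < length es → ∃ λ ρ′ →
      foldl (λ acc _ → value K improveTerm (n# ∷ C# ∷ acc ∷ [])) (encodeEnv ρ) es ≡ encodeEnv ρ′ ×
      Cheap C ρ′ × Stuck ρ′
    improvements []       ρ cheap (inj₁ stuck) = ρ , refl , cheap , stuck
    improvements (e ∷ es) ρ cheap progress with improve-correct ρ (small ρ (cheap .proj₁))
    ... | inj₁ (stuck , eq) rewrite eq = improvements es ρ cheap (inj₁ stuck)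
    ... | inj₂ (ρ′ , ρ′∈ , improves , eq) rewrite eq =
      improvements es ρ′ (cheap-improves {C = C} (∈-assignments⁻ ρ ρ′∈) improves cheap)
        (inj₂ (fewer progress))
      where
      fewer : Stuck ρ ⊎ count C ρ < suc (length es) → count C ρ′ < length es
      fewer (inj₁ stuck)      = contradiction improves (stuck ρ′∈)
      fewer (inj₂ (s≤s less)) = <-≤-trans (≤-trans (m<m+n (count C ρ′) (s≤s z≤n)) improves) less

    opaque
      unfolding greedyTerm

      greedy-correct : size C < 3 * (n ∸ 1) → ∃ λ ρ →
        value K greedyTerm (n# ∷ C# ∷ []) ≡ encodeEnv ρ × Cheap C ρ × Stuck ρ
      greedy-correct small
        rewrite initial-correct n n≤K | take-spine {C#} code≤ =
        improvements (spine C#) (initial n) (cheap-initial n C small)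
          (inj₂ (≤-<-trans (count≤gates C (initial n))
            (subst (gates C <_) (sym (length-spine C#)) (gates<code C))))

    opaque
      unfolding ifWrongTerm

      ifWrong-correct : ∀ x → let r = value K ifWrongTerm (n# ∷ C# ∷ encodeBits x ∷ []) in
        (Correct C x × r ≡ nil) ⊎ (¬ Correct C x × r ≡ cons nil (encodeBits x))
      ifWrong-correct x rewrite wrong-correct x | XOR-parity x with eval C x | parity x
      ... | false | false = inj₁ (refl , refl)
      ... | false | true  = inj₂ ((λ ()) , refl)
      ... | true  | false = inj₂ ((λ ()) , refl)
      ... | true  | true  = inj₁ (refl , refl)

    private
      inner : Term 5
      inner = search (call assignmentsTerm (v1 ∷ []))
        (call ifWrongTerm (v4 ∷ v5 ∷ call fillTerm (v1 ∷ []) ∷ []))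

      check : Tree → Tree
      check e = value K ifWrongTerm (n# ∷ C# ∷ value K fillTerm (e ∷ []) ∷ [])

      check≡ : ∀ (ρ : Vec Abs n) →
        check (encodeEnv ρ) ≡ value K ifWrongTerm (n# ∷ C# ∷ encodeBits (fill ρ) ∷ [])
      check≡ ρ = cong (λ t → value K ifWrongTerm (n# ∷ C# ∷ t ∷ [])) (fill-correct ρ n≤K)

    opaque
      unfolding counterexampleTerm

      counterexample-correct : ∀ ρ → Cheap C ρ → Stuck ρ → ∃ λ x → ¬ Correct C x ×
        value K counterexampleTerm (n# ∷ C# ∷ encodeEnv ρ ∷ []) ≡ cons nil (encodeBits x)
      counterexample-correct ρ cheap stuck
        with search-correct encodeEnv (call assignmentsTerm (v2 ∷ [])) inner (assignments ρ)
          (n# ∷ C# ∷ encodeEnv ρ ∷ []) (λ e → value K inner (nil ∷ e ∷ n# ∷ C# ∷ encodeEnv ρ ∷ []))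
          (λ _ _ → refl) (assignments-correct ρ inputs≤) (assignments≤ ρ)
      -- An empty search would certify every candidate as correct.
      ... | inj₁ (_ , none) = ⊥-elim (counterexample-exists C cheap stuck correct)
        where
        correct : ∀ {ρ′ ρ″} → ρ′ ∈ assignments ρ → ρ″ ∈ assignments ρ′ → Correct C (fill ρ″)
        correct {ρ′} {ρ″} ρ′∈ ρ″∈
          with search-correct encodeEnv (call assignmentsTerm (v1 ∷ []))
            (call ifWrongTerm (v4 ∷ v5 ∷ call fillTerm (v1 ∷ []) ∷ []))
            (assignments ρ′) (nil ∷ encodeEnv ρ′ ∷ n# ∷ C# ∷ encodeEnv ρ ∷ []) check
            (λ _ _ → refl) (assignments-correct ρ′ inputs≤) (assignments≤ ρ′)
        ... | inj₂ (_ , _ , r≡ , some) = contradiction (trans (sym r≡) (none ρ′∈)) some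
        ... | inj₁ (_ , none′) with ifWrong-correct (fill ρ″)
        ...   | inj₁ (right , _) = right
        ...   | inj₂ (_ , eq) with () ← trans (sym (none′ ρ″∈)) (trans (check≡ ρ″) eq)
      ... | inj₂ (ρ′ , ρ′∈ , r≡ , some)
        with search-correct encodeEnv (call assignmentsTerm (v1 ∷ []))
            (call ifWrongTerm (v4 ∷ v5 ∷ call fillTerm (v1 ∷ []) ∷ []))
            (assignments ρ′) (nil ∷ encodeEnv ρ′ ∷ n# ∷ C# ∷ encodeEnv ρ ∷ []) check
            (λ _ _ → refl) (assignments-correct ρ′ inputs≤) (assignments≤ ρ′)
      ...   | inj₁ (r′≡ , _) = contradiction r′≡ some
      ...   | inj₂ (ρ″ , _ , r′≡ , some′) with ifWrong-correct (fill ρ″)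
      ...     | inj₁ (_ , eq)     = contradiction (trans (check≡ ρ″) eq) some′
      ...     | inj₂ (wrong , eq) = fill ρ″ , wrong , trans r≡ (trans r′≡ (trans (check≡ ρ″) eq))

    opaque
      unfolding refuteTerm

      refute-correct : size C < 3 * (n ∸ 1) → ∃ λ x → ¬ Correct C x ×
        value K refuteTerm (encodeInput n C ∷ []) ≡ encodeBits x
      refute-correct small with greedy-correct small
      ... | ρ , eq , cheap , stuck rewrite eq with counterexample-correct ρ cheap stuck
      ...   | x , wrong , eq′ = x , wrong , cong tail eq′

-- The program and its running time

-- The iterations of folds are counted by the code of the circuit, lengthened by
-- twice the number of inputs.
refuter : Cmd 4
refuter =
  env# := cons acc nil ⟫ stk# := hd acc ⟫ ful# := tl acc ⟫
  while stk loop (ful# := cons nil (cons nil ful) ⟫ stk# := tl stk) ⟫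
  compile refuteTerm

lengthen : ℕ → Tree → Tree
lengthen zero    t = t
lengthen (suc n) t = lengthen n (cons nil (cons nil t))

∣lengthen∣ : ∀ n t → ∣ lengthen n t ∣ ≡ n + n + ∣ t ∣
∣lengthen∣ zero    t = refl
∣lengthen∣ (suc n) t = trans (∣lengthen∣ n (cons nil (cons nil t))) (arith n ∣ t ∣)
  where
  arith : ∀ n k → n + n + suc (suc k) ≡ suc n + suc n + k
  arith = solve-∀

lengthen-correct : ∀ N n a e t →
  RunsLoop N n stk (ful# := cons nil (cons nil ful) ⟫ stk# := tl stk)
    (a ∷ e ∷ encodeℕ n ∷ t ∷ []) (a ∷ e ∷ nil ∷ lengthen n t ∷ [])
lengthen-correct N zero    a e t = stopᵣ refl
lengthen-correct N (suc n) a e t =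
  stepᵣ refl (assignᵣ ⨾ᵣ assignᵣ) (lengthen-correct N n a e (cons nil (cons nil t)))

-- In `K`, the part `n + n` is the number of assignments of one environment and `∣ c ∣` the length
-- of the circuit code; together they also bound the number of wires.
refuter-correct : ∀ {N} n c → n + n + ∣ c ∣ ≤ N → let K = n + n + ∣ c ∣ in ∃ λ τ →
  Runs N refuter (cons (encodeℕ n) c ∷ nil ∷ nil ∷ nil ∷ [])
    (value K refuteTerm (cons (encodeℕ n) c ∷ []) ∷ τ)
refuter-correct {N} n c h = _ , assignᵣ ⨾ᵣ assignᵣ ⨾ᵣ assignᵣ ⨾ᵣ
  loopᵣ (≤-trans (≤-trans (m≤m+n n n) (m≤m+n (n + n) ∣ c ∣)) h) (lengthen-correct N n _ _ c) ⨾ᵣ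
  subst (λ k → Runs N (compile refuteTerm)
      (input ∷ cons input nil ∷ nil ∷ lengthen n c ∷ [])
      (value k refuteTerm (input ∷ []) ∷ cons input nil ∷ nil ∷ lengthen n c ∷ []))
    (∣lengthen∣ n c)
    (compile-correct (lengthen n c) (subst (_≤ N) (sym (∣lengthen∣ n c)) h) refuteTerm
      (input ∷ []) input nil)
  where
  input = cons (encodeℕ n) c

gates≡ : ∀ {w} (C : Circuit w) → gates C ≡ size C + freeGates C
gates≡ (output _)    = refl
gates≡ (const _ ▷ C) = trans (cong suc (gates≡ C)) (sym (+-suc (size C) (freeGates C)))
gates≡ (neg _ ▷ C)   = trans (cong suc (gates≡ C)) (sym (+-suc (size C) (freeGates C)))
gates≡ (and _ _ ▷ C) = cong suc (gates≡ C)
gates≡ (or _ _ ▷ C)  = cong suc (gates≡ C)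

-- Gates count twice: each contributes an entry of its own and raises the bound on the index of the
-- output by one.
code≤ : ∀ {w} (C : Circuit w) → ∣ encodeCircuit C ∣ ≤ w + (gates C + gates C)
code≤ {w} (output i) rewrite ∣ℕ∣ (toℕ i) | +-identityʳ w = toℕ<n i
code≤ {w} (g ▷ C) = subst (suc ∣ encodeCircuit C ∣ ≤_) (arith w (gates C)) (s≤s (code≤ C))
  where
  arith : ∀ w k → suc (suc w + (k + k)) ≡ w + (suc k + suc k)
  arith = solve-∀

-- The coefficient of `n` is 9 = 2 + 1 + 2 · 3: twice `n` for the assignments, then `code≤` with
-- fewer than `3 * n` binary gates. For the free gates 2 would do and is raised to 9.
fuelPoly : Polynomial
fuelPoly = 0 ∷ 9 ∷ []

fuel≤ : ∀ {n} (C : Circuit n) → size C < 3 * (n ∸ 1) →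
  n + n + ∣ encodeCircuit C ∣ ≤ evalPoly fuelPoly (n + freeGates C)
fuel≤ {n} C small = begin
  n + n + ∣ encodeCircuit C ∣         ≤⟨ +-monoʳ-≤ (n + n) (code≤ C) ⟩
  n + n + (n + (gates C + gates C))   ≤⟨ +-monoʳ-≤ (n + n) (+-monoʳ-≤ n (+-mono-≤ gates≤ gates≤)) ⟩
  n + n + (n + (3 * n + f + (3 * n + f)))   ≡⟨ arith n f ⟩
  9 * n + 2 * f                       ≤⟨ +-monoʳ-≤ (9 * n) (*-monoˡ-≤ f {2} {9} (s≤s (s≤s z≤n))) ⟩
  9 * n + 9 * f                       ≡⟨ arith′ n f ⟩
  evalPoly fuelPoly (n + f)           ∎
  where
  open ≤-Reasoning
  f = freeGates C
  gates≤ : gates C ≤ 3 * n + f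
  gates≤ = subst (_≤ 3 * n + f) (sym (gates≡ C))
    (+-monoˡ-≤ f (≤-trans (<⇒≤ small) (*-monoʳ-≤ 3 (m∸n≤m n 1))))
  arith : ∀ n f → n + n + (n + (3 * n + f + (3 * n + f))) ≡ 9 * n + 2 * f
  arith = solve-∀
  arith′ : ∀ n f → 9 * n + 9 * f ≡ (n + f) * (9 + (n + f) * 0)
  arith′ = solve-∀

theorem21 : ∃ λ (P : Program) → ∃ λ (q : Polynomial) →
    ∀ (n : ℕ) (C : Circuit n) → size C < 3 * (n ∸ 1) →
    ∃ λ (x : Vec Bool n) → ∃ λ (t : ℕ) →
    (bit (eval C x) ≢ XOR x)
    × (P on encodeInput n C outputs encodeBits x inTime t)
    × (t ≤ evalPoly q (n + freeGates C))
theorem21 = program 3 refuter , boundPoly refuter fuelPoly , λ n C small →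
  let M = n + freeGates C
      c = ∣ encodeCircuit C ∣
      x , wrong , x≡ = refute-correct C (m≤m+n (n + n) c)
        (+-mono-≤ (m≤m+n n n) (<⇒≤ (gates<code C))) (m≤n+m c (n + n)) small
      τ , within {steps} run steps≤ = refuter-correct n (encodeCircuit C) (fuel≤ C small)
  in x , steps , wrong , (_ , run , x≡) ,
     subst (steps ≤_) (sym (boundPoly-correct refuter fuelPoly M)) steps≤
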